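{- Let $\tau=\frac12(1+\sqrt5)$. Then $L_\oplus(-\tau)=2$ and $L_\otimes(-\tau)=2$.
   Context: Ito–Sadahiro $(-\beta)$-expansions. For real $\beta>1$ put $l_\beta=-\frac{\beta}{\beta+1}$, $r_\beta=1+l_\beta=\frac{1}{\beta+1}$, and define $T_{ -\beta}:[l_\beta,r_\beta)\to[l_\beta,r_\beta)$ by $T_{ -\beta}(y)=-\beta y-\lfloor-\beta y-l_\beta\rfloor$. For $y\in[l_\beta,r_\beta)$ put $d_{ -\beta}(y)=y_1y_2y_3\cdots$ where $y_i=\lfloor-\beta T_{ -\beta}^{i-1}(y)-l_\beta\rfloor$ for $i\ge1$; then $y=\sum_{i\ge1}y_i(-\beta)^{ -i}$. For $x\in\mathbb{R}$, a $(-\beta)$-representation of $x$ is an expression $x=\sum_{i=-\infty}^{k}x_i(-\beta)^i$ with $k\in\mathbb{Z}$ and $x_i\in\mathbb{Z}$. The $(-\beta)$-expansion of $x$ is the $(-\beta)$-representation for which $x_kx_{k-1}x_{k-2}\cdots=d_{ -\beta}(y)$ for some $y$ in the open interval $(l_\beta,r_\beta)$; it exists and is unique up to leading zeros. The set $\mathbb{Z}_{ -\beta}$ of $(-\beta)$-integers consists of all $x\in\mathbb{R}$ whose $(-\beta)$-expansion has $x_i=0$ for all $i<0$, and $\mathrm{Fin}(-\beta)=\bigcup_{k\in\mathbb{Z}}(-\beta)^k\mathbb{Z}_{ -\beta}$. Define $$L_\oplus(-\beta)=\min\{l\in\mathbb{N}\mid \forall\,x,y\in\mathbb{Z}_{ -\beta},\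 x+y\in\mathrm{Fin}(-\beta)\Rightarrow x+y\in(-\beta)^{ -l}\mathbb{Z}_{ -\beta}\},$$ $$L_\otimes(-\beta)=\min\{l\in\mathbb{N}\mid \forall\,x,y\in\mathbb{Z}_{ -\beta},\ x\cdot y\in\mathrm{Fin}(-\beta)\Rightarrow x\cdot y\in(-\beta)^{ -l}\mathbb{Z}_{ -\beta}\}.$$ -}

module Defs where

open import Level using (Level; _⊔_) renaming (suc to lsuc)
open import Data.Empty using (⊥-elim)
open import Data.Fin.Base using (toℕ)
open import Data.Integer.Base as ℤ using (ℤ; +_; -[1+_])
open import Data.Nat.Base as ℕ using (ℕ; suc)
open import Data.Product.Base using (Σ-syntax; ∃-syntax; _×_; _,_; proj₁; proj₂)
open import Data.Sum.Base using (_⊎_; inj₁; inj₂)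
open import Relation.Binary.PropositionalEquality.Core using (_≡_)
open import Relation.Binary.Structures using (IsStrictPartialOrder)
open import Relation.Nullary.Negation.Core using (¬_)
open import Algebra.Apartness.Bundles using (HeytingField; HeytingCommutativeRing)
open import Algebra.Bundles using (CommutativeRing; CommutativeSemiring)

import Algebra.Apartness.Properties.HeytingCommutativeRing as HCRProperties
import Algebra.Definitions.RawSemiring as RawSemiringDefs
import Algebra.Properties.Group as GroupProperties
import Algebra.Solver.Ring.NaturalCoefficients.Default as SemiringSolver
import Relation.Binary.Reasoning.Setoid as SetoidReasoning

-- The real numbers, axiomatised as a Cauchy-complete Archimedean ordered
-- field.  Trichotomy is not assumed: apartness is required to coincide with
-- being strictly ordered one way or the other, so the axioms hold for the
-- classical reals as well as for Bishop's constructive reals.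
record Reals (c ℓ₁ ℓ₂ : Level) : Set (lsuc (c ⊔ ℓ₁ ⊔ ℓ₂)) where
  infix 4 _<_ _≤_ ∣_∣<_ _ConvergesTo_
  field
    heytingField : HeytingField c ℓ₁ ℓ₂

  open HeytingField heytingField public

  commutativeRing : CommutativeRing c ℓ₁
  commutativeRing = HeytingCommutativeRing.commutativeRing heytingCommutativeRing

  open CommutativeRing commutativeRing public
    using (commutativeSemiring; +-group)
  open RawSemiringDefs (CommutativeSemiring.rawSemiring commutativeSemiring) public
    using (_^_; sum) renaming (_×_ to _·_)

  field
    _<_                  : Carrier → Carrier → Set ℓ₂
    isStrictPartialOrder : IsStrictPartialOrder _≈_ _<_
    #⇒<⊎>                : ∀ {x y} → x # y → x < y ⊎ y < x
    <⇒#                  : ∀ {x y} → x < y → x # y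
    0<1                  : 0# < 1#
    +-monoˡ-<            : ∀ {x y} z → x < y → x + z < y + z
    *-pos                : ∀ {x y} → 0# < x → 0# < y → 0# < x * y

  _≤_ : Carrier → Carrier → Set ℓ₂
  x ≤ y = ¬ (y < x)

  ∣_∣<_ : Carrier → Carrier → Set ℓ₂
  ∣ x ∣< ε = - ε < x × x < ε

  IsCauchy : (ℕ → Carrier) → Set (c ⊔ ℓ₂)
  IsCauchy a = ∀ ε → 0# < ε →
    ∃[ N ] (∀ m n → N ℕ.≤ m → N ℕ.≤ n → ∣ a m - a n ∣< ε)

  _ConvergesTo_ : (ℕ → Carrier) → Carrier → Set (c ⊔ ℓ₂)
  a ConvergesTo x = ∀ ε → 0# < ε →
    ∃[ N ] (∀ n → N ℕ.≤ n → ∣ a n - x ∣< ε)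

  field
    archimedean : ∀ x → ∃[ n ] x < n · 1#
    complete    : ∀ a → IsCauchy a → ∃[ x ] a ConvergesTo x

module RealProperties {c ℓ₁ ℓ₂} (ℝ : Reals c ℓ₁ ℓ₂) where
  open Reals ℝ
  open IsStrictPartialOrder isStrictPartialOrder public
    using (<-resp-≈; <-respʳ-≈; <-respˡ-≈)
    renaming (irrefl to <-irrefl; trans to <-trans; asym to <-asym)
  open HCRProperties heytingCommutativeRing using (x-0≈x; invertibleʳ⇒#)
  open GroupProperties +-group using (//-rightDividesˡ)
  open SetoidReasoning setoid

  fromℤ : ℤ → Carrier
  fromℤ (+ n)    = n · 1#
  fromℤ -[1+ n ] = - (suc n · 1#)

  inv : ∀ x → 0# < x → Carrier
  inv x 0<x = proj₁ (#⇒invertible (#-sym (<⇒# 0<x)))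

  inv-inverseʳ : ∀ x (0<x : 0# < x) → x * inv x 0<x ≈ 1#
  inv-inverseʳ x 0<x = trans (*-congʳ (sym (x-0≈x x)))
    (proj₂ (proj₂ (#⇒invertible (#-sym (<⇒# 0<x)))))

  +-monoʳ-< : ∀ {x y} z → x < y → z + x < z + y
  +-monoʳ-< {x} {y} z x<y =
    <-respˡ-≈ (+-comm x z) (<-respʳ-≈ (+-comm y z) (+-monoˡ-< z x<y))

  pos+pos : ∀ {x y} → 0# < x → 0# < y → 0# < x + y
  pos+pos {x} {y} 0<x 0<y =
    <-trans 0<y (<-respˡ-≈ (+-identityˡ y) (+-monoˡ-< y 0<x))

  0<2 : 0# < 1# + 1#
  0<2 = pos+pos 0<1 0<1

  ½ : Carrier
  ½ = inv (1# + 1#) 0<2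

  *-monoˡ-<-pos : ∀ {x y z} → 0# < z → x < y → z * x < z * y
  *-monoˡ-<-pos {x} {y} {z} 0<z x<y =
    <-respˡ-≈ (+-identityˡ (z * x))
      (<-respʳ-≈
        (trans (sym (distribˡ z (y - x) x)) (*-congˡ (//-rightDividesˡ x y)))
        (+-monoˡ-< (z * x) (*-pos 0<z 0<y-x)))
    where
    0<y-x : 0# < y - x
    0<y-x = <-respˡ-≈ (-‿inverseʳ x) (+-monoˡ-< (- x) x<y)

  module GoldenRatio (√5 : Carrier) (0<√5 : 0# < √5) (√5²≈5 : √5 * √5 ≈ 5 · 1#) where

    τ : Carrier
    τ = ½ * (1# + √5)

    2τ≈1+√5 : (1# + 1#) * τ ≈ 1# + √5
    2τ≈1+√5 = trans (sym (*-assoc _ _ _))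
      (trans (*-congʳ (inv-inverseʳ _ 0<2)) (*-identityˡ _))

    τ²≈1+τ : τ * τ ≈ 1# + τ
    τ²≈1+τ = begin
      τ * τ
        ≈⟨ solve 2 (λ h s → (h :* (con 1 :+ s)) :* (h :* (con 1 :+ s))
                    := (h :* h) :* (con 1 :+ con 2 :* s :+ s :* s)) refl ½ √5 ⟩
      (½ * ½) * (1# + (1# + 1#) * √5 + √5 * √5)
        ≈⟨ *-congˡ (+-congˡ √5²≈5) ⟩
      (½ * ½) * (1# + (1# + 1#) * √5 + 5 · 1#)
        ≈⟨ solve 2 (λ h s → (h :* h) :* (con 1 :+ con 2 :* s
                        :+ (con 1 :+ (con 1 :+ (con 1 :+ (con 1 :+ (con 1 :+ con 0))))))
                    := (con 2 :* h) :* (con 2 :* h :+ h :* (con 1 :+ s))) refl ½ √5 ⟩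
      ((1# + 1#) * ½) * ((1# + 1#) * ½ + τ)
        ≈⟨ *-cong (inv-inverseʳ _ 0<2) (+-congʳ (inv-inverseʳ _ 0<2)) ⟩
      1# * (1# + τ)
        ≈⟨ *-identityˡ _ ⟩
      1# + τ ∎
      where open SemiringSolver commutativeSemiring

    τ#1 : τ # 1#
    τ#1 = invertibleʳ⇒# (τ , (begin
      (τ - 1#) * τ           ≈⟨ distribʳ τ τ (- 1#) ⟩
      τ * τ + - 1# * τ       ≈⟨ +-congʳ τ²≈1+τ ⟩
      1# + τ + - 1# * τ      ≈⟨ +-congʳ (+-congˡ (*-identityˡ τ)) ⟨
      1# + 1# * τ + - 1# * τ ≈⟨ +-assoc _ _ _ ⟩
      1# + (1# * τ + - 1# * τ) ≈⟨ +-congˡ (distribʳ τ 1# (- 1#)) ⟨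
      1# + (1# - 1#) * τ     ≈⟨ +-congˡ (*-congʳ (-‿inverseʳ 1#)) ⟩
      1# + 0# * τ            ≈⟨ +-congˡ (zeroˡ τ) ⟩
      1# + 0#                ≈⟨ +-identityʳ 1# ⟩
      1# ∎))

    √5≮1 : ¬ (√5 < 1#)
    √5≮1 √5<1 = <-asym √5²<1 1<√5²
      where
      √5²<1 : √5 * √5 < 1#
      √5²<1 = <-trans
        (<-respʳ-≈ (*-identityʳ √5) (*-monoˡ-<-pos 0<√5 √5<1)) √5<1
      0<4 : 0# < 4 · 1#
      0<4 = pos+pos 0<1 (pos+pos 0<1 (pos+pos 0<1
        (<-respʳ-≈ (sym (+-identityʳ 1#)) 0<1)))
      1<√5² : 1# < √5 * √5
      1<√5² = <-respʳ-≈ (sym √5²≈5)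
        (<-respˡ-≈ (+-identityʳ 1#) (+-monoʳ-< 1# 0<4))

    τ≮1 : ¬ (τ < 1#)
    τ≮1 τ<1 = √5≮1
      (<-respˡ-≈ (cancel √5) (<-respʳ-≈ (cancel 1#) (+-monoʳ-< (- 1#)
        (<-respˡ-≈ 2τ≈1+√5
          (<-respʳ-≈ (*-identityʳ _) (*-monoˡ-<-pos 0<2 τ<1))))))
      where
      cancel : ∀ x → - 1# + (1# + x) ≈ x
      cancel x = trans (sym (+-assoc _ _ _))
        (trans (+-congʳ (-‿inverseˡ 1#)) (+-identityˡ x))

    1<τ : 1# < τ
    1<τ with #⇒<⊎> τ#1
    ... | inj₁ τ<1 = ⊥-elim (τ≮1 τ<1)
    ... | inj₂ 1<τ = 1<τ

module MinusBeta {c ℓ₁ ℓ₂} (ℝ : Reals c ℓ₁ ℓ₂)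
  (β : Reals.Carrier ℝ) (1<β : Reals._<_ ℝ (Reals.1# ℝ) β) where
  open Reals ℝ
  open RealProperties ℝ

  0<β : 0# < β
  0<β = <-trans 0<1 1<β

  l r : Carrier
  l = - (β * inv (β + 1#) (pos+pos 0<β 0<1))
  r = 1# + l

  infixr 8 -β^_
  -β^_ : ℤ → Carrier
  -β^ (+ n)    = (- β) ^ n
  -β^ -[1+ n ] = (- inv β 0<β) ^ suc n

  -- Floors are taken relationally: the integer part is not a computable
  -- function on constructive reals.
  IsFloor : Carrier → ℤ → Set ℓ₂
  IsFloor x n = fromℤ n ≤ x × x < fromℤ n + 1#

  -- T y z says that T₋β(y) is defined and equal to z, for y in [l , r).
  T : Carrier → Carrier → Set (ℓ₁ ⊔ ℓ₂)
  T y z = Σ[ n ∈ ℤ ] (IsFloor (- β * y - l) n × z ≈ - β * y - fromℤ n)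

  -- d₋β(y) = y₁y₂y₃⋯, where the digit yᵢ is d (i - 1) and t is the orbit of y.
  record IsDigitString (y : Carrier) (d : ℕ → ℤ) : Set (c ⊔ ℓ₁ ⊔ ℓ₂) where
    field
      l≤y   : l ≤ y
      y<r   : y < r
      t     : ℕ → Carrier
      start : t 0 ≈ y
      step  : ∀ i → T (t i) (t (suc i))
      digit : ∀ i → IsFloor (- β * t i - l) (d i)

  -- x = ∑_{i ≤ k} xᵢ (-β)ⁱ, as a limit of partial sums taken from the leading
  -- term downwards.  Positions above k are filled with zeros.
  record IsRepresentation (x : Carrier) (k : ℤ) (xs : ℤ → ℤ) : Set (c ⊔ ℓ₂) where
    partialSum : ℕ → Carrier
    partialSum n = sum {n} λ j → let i = k ℤ.- + toℕ j in fromℤ (xs i) * -β^ i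

    field
      zero-above : ∀ i → k ℤ.< i → xs i ≡ + 0
      converges  : partialSum ConvergesTo x

  record Expansion (x : Carrier) : Set (c ⊔ ℓ₁ ⊔ ℓ₂) where
    field
      k                : ℤ
      xs               : ℤ → ℤ
      isRepresentation : IsRepresentation x k xs
      y                : Carrier
      l<y              : l < y
      y<r              : y < r
      isDigitString    : IsDigitString y (λ j → xs (k ℤ.- + j))

  -- Expansions are unique up to leading zeros, so it does not matter which
  -- expansion of x is inspected.
  ℤ₋β : Carrier → Set (c ⊔ ℓ₁ ⊔ ℓ₂)
  ℤ₋β x = Σ[ e ∈ Expansion x ] (∀ i → i ℤ.< + 0 → Expansion.xs e i ≡ + 0)

  infix 4 _∈-β^_ℤ₋β
  _∈-β^_ℤ₋β : Carrier → ℤ → Set (c ⊔ ℓ₁ ⊔ ℓ₂)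
  x ∈-β^ k ℤ₋β = ∃[ z ] (ℤ₋β z × x ≈ -β^ k * z)

  Fin₋β : Carrier → Set (c ⊔ ℓ₁ ⊔ ℓ₂)
  Fin₋β x = Σ[ k ∈ ℤ ] (x ∈-β^ k ℤ₋β)

  IsMin : ∀ {ℓ} → (ℕ → Set ℓ) → ℕ → Set ℓ
  IsMin P m = P m × (∀ n → P n → m ℕ.≤ n)

  BoundsFractionalDigits : (Carrier → Carrier → Carrier) → ℕ → Set (c ⊔ ℓ₁ ⊔ ℓ₂)
  BoundsFractionalDigits _∙_ n = ∀ x y → ℤ₋β x → ℤ₋β y →
    Fin₋β (x ∙ y) → (x ∙ y) ∈-β^ ℤ.- + n ℤ₋β

  infix 4 L⊕≡_ L⊗≡_
  L⊕≡_ L⊗≡_ : ℕ → Set (c ⊔ ℓ₁ ⊔ ℓ₂)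
  L⊕≡_ = IsMin (BoundsFractionalDigits _+_)
  L⊗≡_ = IsMin (BoundsFractionalDigits _*_)

{-# OPTIONS --safe #-}

-- Write x′ for the conjugate of x ∈ ℤ[τ], so that (-τ)′ = 1/τ.  The (-τ)-integers are exactly the
-- x ∈ ℤ[τ] with 0 ≤ x′ < τ².  Indeed the digits are 0 or 1, so appending a digit maps the
-- conjugate by t ↦ t/τ or t ↦ t/τ + 1, and both preserve [0, τ²).  Conversely, for such an x the
-- remainder left by T after the integer digits lies in [l , r) and has a conjugate in (-τ², τ²);
-- only 0 and l satisfy this, and l is impossible.  Sums and products of two (-τ)-integers have
-- conjugates in [0, 2τ²) and [0, τ⁴), which division by τ² moves into [0, τ²).  Two digits are
-- needed because (-√5) + (-√5) and (-√5)(-√5) have conjugates 2√5 and 5, both at least τ³.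
module Submission where

open import Defs
open import Algebra.Bundles using (CommutativeRing)
open import Algebra.Solver.Ring.AlmostCommutativeRing
  using (fromCommutativeRing; _-Raw-AlmostCommutative⟶_; AlmostCommutativeRing)
open import Algebra.Structures using (IsCommutativeRing)
open import Data.Empty using (⊥)
open import Data.Fin.Base using (Fin; zero; suc; toℕ)
open import Data.Integer.Base as ℤ using (ℤ; +_; -[1+_]; _⊖_; _◃_)
open import Data.Integer.Properties as ℤₚ using (m-n≡m⊖n; [1+m]⊖[1+n]≡m⊖n)
open import Data.Integer.Solver using (module +-*-Solver)
import Data.Maybe.Base as Maybe
open import Data.Nat.Base as ℕ using (ℕ; zero; suc)
import Data.Nat.Properties as ℕₚ
open import Data.Product.Base using (∃-syntax; _×_; _,_; proj₁; proj₂)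
open import Data.Product.Properties using (≡-dec)
open import Data.Sign.Base as Sign using ()
open import Data.Sum.Base using (_⊎_; inj₁; inj₂)
open import Data.Unit.Base using (⊤)
open import Function.Base using (_∘_)
open import Relation.Nullary.Negation.Core using (¬_; contradiction)
open import Relation.Binary.Consequences using (dec⇒weaklyDec)
open import Relation.Binary.Definitions using (DecidableEquality)
open import Relation.Binary.PropositionalEquality.Core as ≡ using (_≡_; cong; cong₂; subst)
open import Relation.Binary.PropositionalEquality.Properties as ≡ using ()
import Algebra.Properties.Ring as RingProperties
import Algebra.Properties.Group as GroupProperties
import Algebra.Properties.Semiring.Exp as SemiringExp
import Algebra.Properties.Semiring.Mult as SemiringMult
import Algebra.Solver.Ring as RingSolver
import Algebra.Solver.Ring.NaturalCoefficients.Default as SemiringSolver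
import Algebra.Solver.Ring.Simple as SimpleRingSolver
import Relation.Binary.Reasoning.Setoid as SetoidReasoning

-- The axioms on the reals do not provide a decidable order, so floors, orbits and sign tests cannot
-- be computed there. They can be computed on pairs of integers: the sign of a + bτ is decidable,
-- and the conjugate of a pair is again a pair, so a bound on a conjugate is a sign condition on
-- another element and needs no second embedding. `φ` carries the results to the reals. Only the
-- digits of a given (-τ)-integer come from an arbitrary real orbit, and all that is taken from that
-- orbit is that they are 0 or 1. For the converse, p is divided by an even power of -τ until the
-- quotient q lies in (-r, r), and the exact orbit of q is followed for as many steps. It ends at e
-- = p - h, where h is the integer spelled by the digits. Both p and h have conjugates in [0, τ²),
-- whence the bound on the conjugate of e.

-- The pair (a , b) stands for a + bτ.
ℤ[τ] : Set
ℤ[τ] = ℤ × ℤ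

-- The ring ℤ[τ] and its conjugation.

infix  8 ⊝_
infixl 7 _⊗_
infixl 6 _⊕_

_⊕_ _⊗_ : ℤ[τ] → ℤ[τ] → ℤ[τ]
(a , b) ⊕ (c , d) = a ℤ.+ c , b ℤ.+ d
(a , b) ⊗ (c , d) = a ℤ.* c ℤ.+ b ℤ.* d , a ℤ.* d ℤ.+ b ℤ.* c ℤ.+ b ℤ.* d

⊝_ conj : ℤ[τ] → ℤ[τ]
⊝ (a , b) = ℤ.- a , ℤ.- b
conj (a , b) = a ℤ.+ b , ℤ.- b

int : ℤ → ℤ[τ]
int n = n , + 0

𝟘 𝟙 : ℤ[τ]
𝟘 = int (+ 0)
𝟙 = int (+ 1)

ℤ[τ]-isCommutativeRing : IsCommutativeRing _≡_ _⊕_ _⊗_ ⊝_ 𝟘 𝟙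
ℤ[τ]-isCommutativeRing = record
  { isRing = record
    { +-isAbelianGroup = record
      { isGroup = record
        { isMonoid = record
          { isSemigroup = record
            { isMagma = record { isEquivalence = ≡.isEquivalence ; ∙-cong = cong₂ _⊕_ }
            ; assoc = λ (a , b) (c , d) (e , f) → cong₂ _,_ (ℤₚ.+-assoc a c e) (ℤₚ.+-assoc b d f)
            }
          ; identity = (λ (a , b) → cong₂ _,_ (ℤₚ.+-identityˡ a) (ℤₚ.+-identityˡ b))
                     , (λ (a , b) → cong₂ _,_ (ℤₚ.+-identityʳ a) (ℤₚ.+-identityʳ b))
          }
        ; inverse = (λ (a , b) → cong₂ _,_ (ℤₚ.+-inverseˡ a) (ℤₚ.+-inverseˡ b))
                  , (λ (a , b) → cong₂ _,_ (ℤₚ.+-inverseʳ a) (ℤₚ.+-inverseʳ b))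
        ; ⁻¹-cong = cong ⊝_
        }
      ; comm = λ (a , b) (c , d) → cong₂ _,_ (ℤₚ.+-comm a c) (ℤₚ.+-comm b d)
      }
    ; *-cong = cong₂ _⊗_
    ; *-assoc = λ (a , b) (c , d) (e , f) → cong₂ _,_
        (solve 6 (λ a b c d e f →
          (a :* c :+ b :* d) :* e :+ (a :* d :+ b :* c :+ b :* d) :* f :=
          a :* (c :* e :+ d :* f) :+ b :* (c :* f :+ d :* e :+ d :* f)) ≡.refl a b c d e f)
        (solve 6 (λ a b c d e f →
          (a :* c :+ b :* d) :* f :+ (a :* d :+ b :* c :+ b :* d) :* e
            :+ (a :* d :+ b :* c :+ b :* d) :* f :=
          a :* (c :* f :+ d :* e :+ d :* f) :+ b :* (c :* e :+ d :* f)
            :+ b :* (c :* f :+ d :* e :+ d :* f)) ≡.refl a b c d e f)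
    ; *-identity = (λ p → ≡.trans (⊗-comm 𝟙 p) (⊗-identityʳ p)) , ⊗-identityʳ
    ; distrib = ⊗-distribˡ
              , λ p q r → ≡.trans (⊗-comm (q ⊕ r) p)
                  (≡.trans (⊗-distribˡ p q r) (cong₂ _⊕_ (⊗-comm p q) (⊗-comm p r)))
    }
  ; *-comm = ⊗-comm
  }
  where
  open +-*-Solver
  ⊗-comm : ∀ p q → p ⊗ q ≡ q ⊗ p
  ⊗-comm (a , b) (c , d) = cong₂ _,_
    (solve 4 (λ a b c d → a :* c :+ b :* d := c :* a :+ d :* b) ≡.refl a b c d)
    (solve 4 (λ a b c d → a :* d :+ b :* c :+ b :* d := c :* b :+ d :* a :+ d :* b)
      ≡.refl a b c d)
  ⊗-identityʳ : ∀ p → p ⊗ 𝟙 ≡ p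
  ⊗-identityʳ (a , b) = cong₂ _,_
    (solve 2 (λ a b → a :* con (+ 1) :+ b :* con (+ 0) := a) ≡.refl a b)
    (solve 2 (λ a b → a :* con (+ 0) :+ b :* con (+ 1) :+ b :* con (+ 0) := b) ≡.refl a b)
  ⊗-distribˡ : ∀ p q r → p ⊗ (q ⊕ r) ≡ p ⊗ q ⊕ p ⊗ r
  ⊗-distribˡ (a , b) (c , d) (e , f) = cong₂ _,_
    (solve 6 (λ a b c d e f → a :* (c :+ e) :+ b :* (d :+ f) :=
      a :* c :+ b :* d :+ (a :* e :+ b :* f)) ≡.refl a b c d e f)
    (solve 6 (λ a b c d e f → a :* (d :+ f) :+ b :* (c :+ e) :+ b :* (d :+ f) :=
      a :* d :+ b :* c :+ b :* d :+ (a :* f :+ b :* e :+ b :* f)) ≡.refl a b c d e f)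

ℤ[τ]-commutativeRing : CommutativeRing _ _
ℤ[τ]-commutativeRing = record { isCommutativeRing = ℤ[τ]-isCommutativeRing }

module 𝒪 = CommutativeRing ℤ[τ]-commutativeRing
module 𝒪ₚ = RingProperties 𝒪.ring
open SemiringExp 𝒪.semiring using () renaming (_^_ to _⊗^_)

_≟𝒪_ : DecidableEquality ℤ[τ]
_≟𝒪_ = ≡-dec ℤₚ._≟_ ℤₚ._≟_

-- The coefficients are the elements of ℤ[τ] themselves, so relations between constants, such as
-- `u ⊗ v ≡ 𝟙`, are settled by evaluation.
module 𝒪-Solver = SimpleRingSolver (fromCommutativeRing ℤ[τ]-commutativeRing) _≟𝒪_

conj-⊕ : ∀ p q → conj (p ⊕ q) ≡ conj p ⊕ conj q
conj-⊕ (a , b) (c , d) = cong₂ _,_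
  (solve 4 (λ a b c d → a :+ c :+ (b :+ d) := a :+ b :+ (c :+ d)) ≡.refl a b c d)
  (solve 2 (λ b d → :- (b :+ d) := :- b :+ :- d) ≡.refl b d)
  where open +-*-Solver

conj-⊗ : ∀ p q → conj (p ⊗ q) ≡ conj p ⊗ conj q
conj-⊗ (a , b) (c , d) = cong₂ _,_
  (solve 4 (λ a b c d → a :* c :+ b :* d :+ (a :* d :+ b :* c :+ b :* d) :=
    (a :+ b) :* (c :+ d) :+ :- b :* :- d) ≡.refl a b c d)
  (solve 4 (λ a b c d → :- (a :* d :+ b :* c :+ b :* d) :=
    (a :+ b) :* :- d :+ :- b :* (c :+ d) :+ :- b :* :- d) ≡.refl a b c d)
  where open +-*-Solver

-- u = -τ and v = 1 - τ are mutually inverse.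
u v : ℤ[τ]
u = + 0 , -[1+ 0 ]
v = + 1 , -[1+ 0 ]

module _ {c ℓ₁ ℓ₂} (ℝ : Reals c ℓ₁ ℓ₂) where
  open Reals ℝ hiding (zero)
  open RealProperties ℝ
  private
    module R = CommutativeRing commutativeRing
  open RingProperties R.ring using (-‿involutive; -‿distribˡ-*; -‿distribʳ-*; -0#≈0#; -‿+-comm)
  open GroupProperties +-group using (//-rightDividesˡ)
  open SemiringMult R.semiring using (×-homo-+; ×1-homo-*)
  open SetoidReasoning setoid

  -- The integers inside the reals.

  fromℤ-⊖ : ∀ m n → fromℤ (m ⊖ n) ≈ m · 1# - n · 1#
  fromℤ-⊖ zero    zero    = sym (-‿inverseʳ 0#)
  fromℤ-⊖ zero    (suc n) = sym (+-identityˡ _)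
  fromℤ-⊖ (suc m) zero    = sym (trans (+-congˡ -0#≈0#) (+-identityʳ _))
  fromℤ-⊖ (suc m) (suc n) = begin
    fromℤ (suc m ⊖ suc n)               ≡⟨ cong fromℤ ([1+m]⊖[1+n]≡m⊖n m n) ⟩
    fromℤ (m ⊖ n)                       ≈⟨ fromℤ-⊖ m n ⟩
    m · 1# - n · 1#                     ≈⟨ +-congˡ (+-identityˡ _) ⟨
    m · 1# + (0# - n · 1#)              ≈⟨ +-congˡ (+-congʳ (-‿inverseʳ 1#)) ⟨
    m · 1# + (1# - 1# - n · 1#)         ≈⟨ +-congˡ (+-assoc _ _ _) ⟩
    m · 1# + (1# + (- 1# - n · 1#))     ≈⟨ +-assoc _ _ _ ⟨
    m · 1# + 1# + (- 1# - n · 1#)       ≈⟨ +-cong (+-comm _ _) (-‿+-comm _ _) ⟩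
    suc m · 1# - suc n · 1#             ∎

  fromℤ-+ : ∀ i j → fromℤ (i ℤ.+ j) ≈ fromℤ i + fromℤ j
  fromℤ-+ (+ m)    (+ n)    = ×-homo-+ 1# m n
  fromℤ-+ (+ m)    -[1+ n ] = fromℤ-⊖ m (suc n)
  fromℤ-+ -[1+ m ] (+ n)    = trans (fromℤ-⊖ n (suc m)) (+-comm _ _)
  fromℤ-+ -[1+ m ] -[1+ n ] = begin
    - (1# + (1# + (m ℕ.+ n) · 1#))  ≡⟨ cong (λ k → - (1# + k · 1#)) (ℕₚ.+-suc m n) ⟨
    - ((suc m ℕ.+ suc n) · 1#)      ≈⟨ -‿cong (×-homo-+ 1# (suc m) (suc n)) ⟩
    - (suc m · 1# + suc n · 1#)     ≈⟨ -‿+-comm _ _ ⟨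
    - (suc m · 1#) - suc n · 1#     ∎

  fromℤ-neg : ∀ i → fromℤ (ℤ.- i) ≈ - fromℤ i
  fromℤ-neg (+ zero)  = sym -0#≈0#
  fromℤ-neg (+ suc n) = refl
  fromℤ-neg -[1+ n ]  = sym (-‿involutive _)

  fromℤ-+◃ : ∀ n → fromℤ (Sign.+ ◃ n) ≈ n · 1#
  fromℤ-+◃ zero    = refl
  fromℤ-+◃ (suc n) = refl

  fromℤ--◃ : ∀ n → fromℤ (Sign.- ◃ n) ≈ - (n · 1#)
  fromℤ--◃ zero    = sym -0#≈0#
  fromℤ--◃ (suc n) = refl

  fromℤ-* : ∀ i j → fromℤ (i ℤ.* j) ≈ fromℤ i * fromℤ j
  fromℤ-* (+ m)    (+ n)    = trans (fromℤ-+◃ (m ℕ.* n)) (×1-homo-* m n)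
  fromℤ-* (+ m)    -[1+ n ] = trans (fromℤ--◃ (m ℕ.* suc n))
    (trans (-‿cong (×1-homo-* m (suc n))) (-‿distribʳ-* _ _))
  fromℤ-* -[1+ m ] (+ n)    = trans (fromℤ--◃ (suc m ℕ.* n))
    (trans (-‿cong (×1-homo-* (suc m) n)) (-‿distribˡ-* _ _))
  fromℤ-* -[1+ m ] -[1+ n ] = begin
    (suc m ℕ.* suc n) · 1#            ≈⟨ ×1-homo-* (suc m) (suc n) ⟩
    suc m · 1# * suc n · 1#           ≈⟨ -‿involutive _ ⟨
    - (- (suc m · 1# * suc n · 1#))   ≈⟨ -‿cong (-‿distribˡ-* _ _) ⟩
    - (- (suc m · 1#) * suc n · 1#)   ≈⟨ -‿distribʳ-* _ _ ⟩
    - (suc m · 1#) * - (suc n · 1#)   ∎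

  module GoldenEmbedding (τ : Carrier) (1<τ : 1# < τ) (τ²≈1+τ : τ * τ ≈ 1# + τ) where

    -- The embedding of ℤ[τ] into the reals.

    φ : ℤ[τ] → Carrier
    φ (a , b) = fromℤ a + fromℤ b * τ

    φ-int : ∀ n → φ (int n) ≈ fromℤ n
    φ-int n = trans (+-congˡ (zeroˡ τ)) (+-identityʳ (fromℤ n))

    φ-𝟘 : φ 𝟘 ≈ 0#
    φ-𝟘 = φ-int (+ 0)

    φ-𝟙 : φ 𝟙 ≈ 1#
    φ-𝟙 = trans (φ-int (+ 1)) (+-identityʳ 1#)

    φ-⊕ : ∀ p q → φ (p ⊕ q) ≈ φ p + φ q
    φ-⊕ (a , b) (c , d) = trans (+-cong (fromℤ-+ a c) (*-congʳ (fromℤ-+ b d)))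
      (solve 5 (λ a b c d t → a :+ c :+ (b :+ d) :* t := a :+ b :* t :+ (c :+ d :* t))
        refl (fromℤ a) (fromℤ b) (fromℤ c) (fromℤ d) τ)
      where open SemiringSolver commutativeSemiring

    φ-⊗ : ∀ p q → φ (p ⊗ q) ≈ φ p * φ q
    φ-⊗ (a , b) (c , d) = begin
      fromℤ (a ℤ.* c ℤ.+ b ℤ.* d) + fromℤ (a ℤ.* d ℤ.+ b ℤ.* c ℤ.+ b ℤ.* d) * τ
        ≈⟨ +-cong (fromℤ-*+* a c b d)
             (*-congʳ (trans (fromℤ-+ (a ℤ.* d ℤ.+ b ℤ.* c) (b ℤ.* d))
               (+-cong (fromℤ-*+* a d b c) (fromℤ-* b d)))) ⟩
      A * C + B * D + (A * D + B * C + B * D) * τ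
        ≈⟨ solve 5 (λ a b c d t → a :* c :+ b :* d :+ (a :* d :+ b :* c :+ b :* d) :* t :=
             a :* c :+ (a :* d :+ b :* c) :* t :+ b :* d :* (con 1 :+ t)) refl A B C D τ ⟩
      A * C + (A * D + B * C) * τ + B * D * (1# + τ)
        ≈⟨ +-congˡ (*-congˡ τ²≈1+τ) ⟨
      A * C + (A * D + B * C) * τ + B * D * (τ * τ)
        ≈⟨ solve 5 (λ a b c d t → a :* c :+ (a :* d :+ b :* c) :* t :+ b :* d :* (t :* t) :=
             (a :+ b :* t) :* (c :+ d :* t)) refl A B C D τ ⟩
      (A + B * τ) * (C + D * τ) ∎
      where
      open SemiringSolver commutativeSemiring
      A = fromℤ a
      B = fromℤ b
      C = fromℤ c
      D = fromℤ d
      fromℤ-*+* : ∀ i j k l → fromℤ (i ℤ.* j ℤ.+ k ℤ.* l) ≈ fromℤ i * fromℤ j + fromℤ k * fromℤ l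
      fromℤ-*+* i j k l = trans (fromℤ-+ (i ℤ.* j) (k ℤ.* l)) (+-cong (fromℤ-* i j) (fromℤ-* k l))

    φ-⊝ : ∀ p → φ (⊝ p) ≈ - φ p
    φ-⊝ (a , b) = trans
      (+-cong (fromℤ-neg a) (trans (*-congʳ (fromℤ-neg b)) (sym (-‿distribˡ-* _ _))))
      (-‿+-comm _ _)

    φ-^ : ∀ p n → φ (p ⊗^ n) ≈ φ p ^ n
    φ-^ p zero    = φ-𝟙
    φ-^ p (suc n) = trans (φ-⊗ p _) (*-congˡ (φ-^ p n))

    φ-homomorphism : AlmostCommutativeRing.rawRing (fromCommutativeRing ℤ[τ]-commutativeRing)
      -Raw-AlmostCommutative⟶ fromCommutativeRing commutativeRing
    φ-homomorphism = record
      { ⟦_⟧ = φ ; +-homo = φ-⊕ ; *-homo = φ-⊗ ; -‿homo = φ-⊝ ; 0-homo = φ-𝟘 ; 1-homo = φ-𝟙 }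

    -- Coefficients from ℤ[τ] act on real unknowns through `φ`, so constants in real identities are
    -- still evaluated on pairs.
    module ℝ-Solver = RingSolver _ _ φ-homomorphism
      (λ p q → Maybe.map (λ p≡q → reflexive (cong φ p≡q)) (dec⇒weaklyDec _≟𝒪_ p q))

    -- Deciding signs in ℤ[τ].

    <⇒pos : ∀ {x y} → x < y → 0# < y - x
    <⇒pos {x} x<y = <-respˡ-≈ (-‿inverseʳ x) (+-monoˡ-< (- x) x<y)

    pos⇒< : ∀ {x y} → 0# < y - x → x < y
    pos⇒< {x} {y} 0<y-x =
      <-respˡ-≈ (+-identityˡ x) (<-respʳ-≈ (//-rightDividesˡ x y) (+-monoˡ-< x 0<y-x))

    -- A record and not an abbreviation, so that p can be inferred.
    record Pos (p : ℤ[τ]) : Set ℓ₂ where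
      constructor mkPos
      field 0<φ : 0# < φ p
    open Pos public

    -- A disjunction with exact zero can be split into cases, unlike `_≤_` on the reals, which is a
    -- negation.
    NonNeg : ℤ[τ] → Set ℓ₂
    NonNeg p = Pos p ⊎ p ≡ 𝟘

    Pos-⊕ : ∀ {p q} → Pos p → Pos q → Pos (p ⊕ q)
    Pos-⊕ {p} {q} (mkPos 0<p) (mkPos 0<q) = mkPos (<-respʳ-≈ (sym (φ-⊕ p q)) (pos+pos 0<p 0<q))

    Pos-⊗ : ∀ {p q} → Pos p → Pos q → Pos (p ⊗ q)
    Pos-⊗ {p} {q} (mkPos 0<p) (mkPos 0<q) = mkPos (<-respʳ-≈ (sym (φ-⊗ p q)) (*-pos 0<p 0<q))

    ¬Pos-𝟘 : ¬ Pos 𝟘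
    ¬Pos-𝟘 (mkPos 0<0) = <-irrefl refl (<-respʳ-≈ φ-𝟘 0<0)

    NonNeg-⊕-Pos : ∀ {p q} → NonNeg p → Pos q → Pos (p ⊕ q)
    NonNeg-⊕-Pos (inj₁ 0<p)        0<q = Pos-⊕ 0<p 0<q
    NonNeg-⊕-Pos {q = q} (inj₂ ≡.refl) 0<q = subst Pos (≡.sym (𝒪.+-identityˡ q)) 0<q

    NonNeg-⊕ : ∀ {p q} → NonNeg p → NonNeg q → NonNeg (p ⊕ q)
    NonNeg-⊕ p≥0 (inj₁ 0<q) = inj₁ (NonNeg-⊕-Pos p≥0 0<q)
    NonNeg-⊕ {p} p≥0 (inj₂ ≡.refl) = subst NonNeg (≡.sym (𝒪.+-identityʳ p)) p≥0

    Pos-⊗-NonNeg : ∀ {p q} → Pos p → NonNeg q → NonNeg (p ⊗ q)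
    Pos-⊗-NonNeg 0<p (inj₁ 0<q) = inj₁ (Pos-⊗ 0<p 0<q)
    Pos-⊗-NonNeg {p} 0<p (inj₂ ≡.refl) = inj₂ (𝒪.zeroʳ p)

    Pos⇒¬NonNeg-⊝ : ∀ {p} → Pos p → ¬ NonNeg (⊝ p)
    Pos⇒¬NonNeg-⊝ {p} 0<p -p≥0 =
      ¬Pos-𝟘 (subst Pos (𝒪.-‿inverseˡ p) (NonNeg-⊕-Pos -p≥0 0<p))

    data Signed (p : ℤ[τ]) : Set ℓ₂ where
      pos  : Pos p → Signed p
      zero : p ≡ 𝟘 → Signed p
      neg  : Pos (⊝ p) → Signed p

    Signed-⊝ : ∀ {p} → Signed p → Signed (⊝ p)
    Signed-⊝ {p} (pos 0<p)    = neg (subst Pos (≡.sym (𝒪ₚ.-‿involutive p)) 0<p)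
    Signed-⊝ (zero ≡.refl) = zero ≡.refl
    Signed-⊝ (neg 0<-p)   = pos 0<-p

    Pos-⊗-Signed : ∀ {p q} → Pos p → Signed q → Signed (p ⊗ q)
    Pos-⊗-Signed 0<p (pos 0<q)     = pos (Pos-⊗ 0<p 0<q)
    Pos-⊗-Signed {p} 0<p (zero ≡.refl) = zero (𝒪.zeroʳ p)
    Pos-⊗-Signed {p} {q} 0<p (neg 0<-q) =
      neg (subst Pos (≡.sym (𝒪ₚ.-‿distribʳ-* p q)) (Pos-⊗ 0<p 0<-q))

    Pos-𝟙 : Pos 𝟙
    Pos-𝟙 = mkPos (<-respʳ-≈ (sym φ-𝟙) 0<1)

    φ-τ : φ (+ 0 , + 1) ≈ τ
    φ-τ = trans (+-identityˡ _) (trans (*-congʳ (+-identityʳ 1#)) (*-identityˡ τ))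

    Pos-τ : Pos (+ 0 , + 1)
    Pos-τ = mkPos (<-respʳ-≈ (sym φ-τ) (<-trans 0<1 1<τ))

    Pos-τ-1 : Pos (⊝ v)
    Pos-τ-1 = mkPos (<-respʳ-≈ (trans (+-cong (sym φ-τ) (sym (trans (φ-⊝ 𝟙) (-‿cong φ-𝟙))))
      (sym (φ-⊕ (+ 0 , + 1) (⊝ 𝟙)))) (<⇒pos 1<τ))

    Pos-+suc-+ : ∀ a b → Pos (+ suc a , + b)
    Pos-+suc-+ zero    zero    = Pos-𝟙
    Pos-+suc-+ zero    (suc b) = Pos-⊕ Pos-τ (Pos-+suc-+ zero b)
    Pos-+suc-+ (suc a) b       = Pos-⊕ Pos-𝟙 (Pos-+suc-+ a b)

    Pos-0-+suc : ∀ b → Pos (+ 0 , + suc b)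
    Pos-0-+suc zero    = Pos-τ
    Pos-0-+suc (suc b) = Pos-⊕ Pos-τ (Pos-0-+suc b)

    -- The element is a(τ - 1) + (k + 1)τ.
    Pos-<-mixed : ∀ a k → Pos (⊝ (+ a , -[1+ a ℕ.+ k ]))
    Pos-<-mixed zero          k = Pos-0-+suc k
    Pos-<-mixed (suc zero)    k = Pos-⊕ Pos-τ-1 (Pos-<-mixed zero k)
    Pos-<-mixed (suc (suc a)) k = Pos-⊕ Pos-τ-1 (Pos-<-mixed (suc a) k)

    Pos-≡-mixed : ∀ b → Pos (⊝ (+ suc b , -[1+ b ]))
    Pos-≡-mixed zero    = Pos-τ-1
    Pos-≡-mixed (suc b) = Pos-⊕ Pos-τ-1 (Pos-≡-mixed b)

    -- For a > b + 1 the identity a - (b+1)τ = (τ-1)((a-b-1)τ - (b+1)) makes the Euclidean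
    -- algorithm decide the sign.
    sign-mixed : ∀ n a b → a ℕ.≤ n → Signed (+ a , -[1+ b ])
    sign-mixed n a b a≤n with ℕ.compare a (suc b)
    ... | ℕ.less a k = neg (Pos-<-mixed a k)
    ... | ℕ.equal a  = neg (Pos-≡-mixed b)
    sign-mixed (suc n) _ b (ℕ.s≤s a≤n) | ℕ.greater (suc b) k =
      subst Signed eq (Pos-⊗-Signed Pos-τ-1
        (Signed-⊝ (sign-mixed n (suc b) k (ℕₚ.≤-trans (ℕₚ.m≤m+n (suc b) k) a≤n))))
      where
      open +-*-Solver
      eq : ⊝ v ⊗ ⊝ (+ suc b , -[1+ k ]) ≡ (+ suc (suc b ℕ.+ k) , -[1+ b ])
      eq = cong₂ _,_
        (≡.trans
          (solve 2 (λ b k → con -[1+ 0 ] :* :- b :+ con (+ 1) :* k := b :+ k) ≡.refl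
            (+ suc b) (+ suc k))
          (cong (λ n → + suc n) (ℕₚ.+-suc b k)))
        (solve 2 (λ b k → con -[1+ 0 ] :* k :+ con (+ 1) :* :- b :+ con (+ 1) :* k := :- b)
          ≡.refl (+ suc b) (+ suc k))

    sign : ∀ p → Signed p
    sign (+ zero     , + zero)     = zero ≡.refl
    sign (+ zero     , + suc b)    = pos (Pos-0-+suc b)
    sign (+ suc a    , + b)        = pos (Pos-+suc-+ a b)
    sign (+ a        , -[1+ b ])   = sign-mixed a a b ℕₚ.≤-refl
    sign (-[1+ a ]   , + zero)     = neg (Pos-+suc-+ a 0)
    sign (-[1+ a ]   , + suc b)    = Signed-⊝ (sign-mixed (suc a) (suc a) b ℕₚ.≤-refl)
    sign (-[1+ a ]   , -[1+ b ])   = neg (Pos-+suc-+ a (suc b))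

    -- Proof by reflection: for a closed p the term `sign p` reduces to a constructor, and the
    -- implicit argument of type `⊤` is then filled in automatically.
    IsPos : ∀ {p} → Signed p → Set
    IsPos (pos _) = ⊤
    IsPos _       = ⊥

    IsNonNeg : ∀ {p} → Signed p → Set
    IsNonNeg (neg _) = ⊥
    IsNonNeg _       = ⊤

    pos! : ∀ p → {IsPos (sign p)} → Pos p
    pos! p {s} with sign p
    ... | pos 0<p = 0<p

    nonNeg! : ∀ p → {IsNonNeg (sign p)} → NonNeg p
    nonNeg! p {s} with sign p
    ... | pos 0<p   = inj₁ 0<p
    ... | zero p≡𝟘 = inj₂ p≡𝟘

    -- A nonzero pair has a strict sign, so its image is not zero. This contains the irrationality
    -- of τ.
    φ-≈0 : ∀ p → φ p ≈ 0# → p ≡ 𝟘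
    φ-≈0 p φp≈0 with sign p
    ... | pos (mkPos 0<p)  = contradiction (<-respʳ-≈ φp≈0 0<p) (<-irrefl refl)
    ... | zero p≡𝟘        = p≡𝟘
    ... | neg (mkPos 0<-p) = contradiction
      (<-respʳ-≈ (trans (φ-⊝ p) (trans (-‿cong φp≈0) -0#≈0#)) 0<-p) (<-irrefl refl)

    φ-injective : ∀ p q → φ p ≈ φ q → p ≡ q
    φ-injective p q φp≈φq = 𝒪ₚ.x∙y⁻¹≈ε⇒x≈y p q (φ-≈0 (p ⊕ ⊝ q)
      (trans (φ-⊕ p (⊝ q)) (trans (+-cong φp≈φq (φ-⊝ q)) (-‿inverseʳ (φ q)))))

    -- v² and v³ are powers of v = -1/τ, and w = 1/τ is the conjugate of u.
    τᵒ τ² v² v³ w : ℤ[τ]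
    τᵒ = + 0 , + 1
    τ² = + 1 , + 1
    v² = + 2 , -[1+ 0 ]
    v³ = + 3 , -[1+ 1 ]
    w  = ⊝ v

    -- l = v and r = v².
    InDomain : ℤ[τ] → Set ℓ₂
    InDomain p = NonNeg (p ⊕ ⊝ v) × Pos (v² ⊕ ⊝ p)

    Window : ℤ[τ] → Set ℓ₂
    Window p = NonNeg (conj p) × Pos (τ² ⊕ ⊝ conj p)

    -- Elements that are small together with their conjugates.

    NonNeg-multiple : ∀ {p} n → NonNeg p → NonNeg (int (+ n) ⊗ p)
    NonNeg-multiple {p} zero    p≥0 = inj₂ (𝒪.zeroˡ p)
    NonNeg-multiple {p} (suc n) p≥0 = subst NonNeg
      (≡.sym (≡.trans (𝒪.distribʳ p 𝟙 (int (+ n))) (cong (_⊕ int (+ n) ⊗ p) (𝒪.*-identityˡ p))))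
      (NonNeg-⊕ p≥0 (NonNeg-multiple n p≥0))

    ¬Pos-progression : ∀ p q n → NonNeg (⊝ p) → NonNeg (⊝ q) → ¬ Pos (p ⊕ int (+ n) ⊗ q)
    ¬Pos-progression p q n p≤0 q≤0 0<p+nq = Pos⇒¬NonNeg-⊝ 0<p+nq (subst NonNeg eq
      (NonNeg-⊕ p≤0 (NonNeg-multiple n q≤0)))
      where
      open 𝒪-Solver
      eq : ⊝ p ⊕ int (+ n) ⊗ ⊝ q ≡ ⊝ (p ⊕ int (+ n) ⊗ q)
      eq = solve 3 (λ p q n → :- p :+ n :* :- q := :- (p :+ n :* q)) ≡.refl p q (int (+ n))

    -- The signs of the closed elements p and q are checked by computation, and the free n disposes
    -- of a whole infinite family of pairs at once.
    impossible : ∀ {ℓ} {A : Set ℓ} p q n {r} {_ : IsNonNeg (sign (⊝ p))} {_ : IsNonNeg (sign (⊝ q))} →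
      r ≡ p ⊕ int (+ n) ⊗ q → Pos r → A
    impossible p q n {_} {p≤0} {q≤0} eq 0<r = contradiction (subst Pos eq 0<r)
      (¬Pos-progression p q n (nonNeg! (⊝ p) {p≤0}) (nonNeg! (⊝ q) {q≤0}))

    -- For p = a + bτ the difference p - p′ is b√5, and the bounds leave only b = -1, 0, 1. Since
    -- [v, v²) has length 1, each b admits a single a, giving v, 𝟘 and -v².
    domain∩window : ∀ p → InDomain p → Pos (τ² ⊕ conj p) → Pos (τ² ⊕ ⊝ conj p) → p ≡ 𝟘 ⊎ p ≡ v
    domain∩window p (inj₂ p-v≡𝟘 , _) _ _ = inj₂ (𝒪ₚ.x∙y⁻¹≈ε⇒x≈y p v p-v≡𝟘)
    domain∩window (a , b) (inj₁ v<p , p<v²) -τ²<p' p'<τ² = go a b v<p p<v² -τ²<p' p'<τ²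
      where
      open +-*-Solver
      -1# : ℤ[τ]
      -1# = ⊝ 𝟙
      -√5 : ℤ[τ]
      -√5 = + 1 , -[1+ 1 ]
      tooSmall : ∀ {ℓ} {A : Set ℓ} c b n {a} {_ : IsNonNeg (sign (⊝ (c , b)))} →
        a ≡ c ℤ.- + n → Pos (a , b) → A
      tooSmall c b n {_} {s} a≡c-n = impossible (c , b) -1# n {_} {s} (cong₂ _,_
        (≡.trans a≡c-n (solve 2 (λ c n → c :- n := c :+ (n :* con -[1+ 0 ] :+ con (+ 0)))
          ≡.refl c (+ n)))
        (solve 2 (λ b n → b := b :+ (n :* con (+ 0) :+ con (+ 0) :+ con (+ 0)))
          ≡.refl b (+ n)))
      go : ∀ a b → Pos ((a , b) ⊕ ⊝ v) → Pos (v² ⊕ ⊝ (a , b)) →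
        Pos (τ² ⊕ conj (a , b)) → Pos (τ² ⊕ ⊝ conj (a , b)) → (a , b) ≡ 𝟘 ⊎ (a , b) ≡ v
      -- The bounds p < v² and -τ² < p′ add up to 3 - b√5 > 0. At b = 2 the left side is 5 - 4τ, and
      -- each further unit of b subtracts √5.
      go a (+ suc (suc m)) _ p<v² -τ²<p' _ = impossible (+ 5 , -[1+ 3 ]) -√5 m
        (cong₂ _,_
          (solve 2 (λ a m → con (+ 2) :- a :+ (con (+ 1) :+ (a :+ (con (+ 2) :+ m))) :=
            con (+ 5) :+ (m :* con (+ 1) :+ con (+ 0))) ≡.refl a (+ m))
          (solve 1 (λ m → con -[1+ 0 ] :- (con (+ 2) :+ m) :+ (con (+ 1) :- (con (+ 2) :+ m)) :=
            con -[1+ 3 ] :+ (m :* con -[1+ 1 ] :+ con (+ 0) :+ con (+ 0))) ≡.refl (+ m)))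
        (Pos-⊕ p<v² -τ²<p')
      -- Here v < p and p′ < τ² add up to 2τ + b√5 > 0, which fails from b = -2 on.
      go a -[1+ suc m ] v<p _ _ p'<τ² = impossible (+ 2 , -[1+ 1 ]) -√5 m
        (cong₂ _,_
          (solve 2 (λ a m → a :- con (+ 1) :+ (con (+ 1) :- (a :- (con (+ 2) :+ m))) :=
            con (+ 2) :+ (m :* con (+ 1) :+ con (+ 0))) ≡.refl a (+ m))
          (solve 1 (λ m → :- (con (+ 2) :+ m) :+ con (+ 1) :+ (con (+ 1) :- (con (+ 2) :+ m)) :=
            con -[1+ 1 ] :+ (m :* con -[1+ 1 ] :+ con (+ 0) :+ con (+ 0))) ≡.refl (+ m)))
        (Pos-⊕ v<p p'<τ²)
      go (+ zero)  (+ zero) _ _ _ _ = inj₁ ≡.refl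
      go (+ suc n) (+ zero) _ p<v² _ _ = tooSmall (+ 1) -[1+ 0 ] n
        (solve 1 (λ n → con (+ 2) :- (con (+ 1) :+ n) := con (+ 1) :- n) ≡.refl (+ n)) p<v²
      go -[1+ n ]  (+ zero) v<p _ _ _ = tooSmall -[1+ 1 ] (+ 1) n
        (solve 1 (λ n → (:- (con (+ 1) :+ n)) :- con (+ 1) := con -[1+ 1 ] :- n) ≡.refl (+ n)) v<p
      go (+ zero)  -[1+ zero ] v<p _ _ _ = impossible (-[1+ 0 ] , + 0) -1# 0 ≡.refl v<p
      go (+ suc zero) -[1+ zero ] _ _ _ _ = inj₂ ≡.refl
      go (+ suc (suc n)) -[1+ zero ] _ p<v² _ _ = tooSmall (+ 0) (+ 0) n
        (solve 1 (λ n → con (+ 2) :- (con (+ 2) :+ n) := con (+ 0) :- n) ≡.refl (+ n)) p<v²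
      go -[1+ n ]  -[1+ zero ] v<p _ _ _ = tooSmall -[1+ 1 ] (+ 0) n
        (solve 1 (λ n → (:- (con (+ 1) :+ n)) :- con (+ 1) := con -[1+ 1 ] :- n) ≡.refl (+ n)) v<p
      go (+ n)     (+ suc zero) _ p<v² _ _ = tooSmall (+ 2) -[1+ 1 ] n
        (solve 1 (λ n → con (+ 2) :- n := con (+ 2) :- n) ≡.refl (+ n)) p<v²
      go -[1+ zero ] (+ suc zero) _ p<v² _ _ = impossible (+ 3 , -[1+ 1 ]) -1# 0 ≡.refl p<v²
      -- This is p = -v², whose conjugate is exactly -τ²: only the strictness of that bound excludes
      -- it.
      go -[1+ suc zero ] (+ suc zero) _ _ -τ²<p' _ = impossible (+ 0 , + 0) -1# 0 ≡.refl -τ²<p'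
      go -[1+ suc (suc n) ] (+ suc zero) v<p _ _ _ = tooSmall -[1+ 3 ] (+ 2) n
        (solve 1 (λ n → (:- (con (+ 3) :+ n)) :- con (+ 1) := con -[1+ 3 ] :- n) ≡.refl (+ n)) v<p

    -- On [l , r) the digit is 1 exactly when -τp - l ≥ 1, that is p ≤ v³.
    digitOf : ∀ {p} → Signed p → ℤ
    digitOf (pos _) = + 0
    digitOf _       = + 1

    digit : ℤ[τ] → ℤ
    digit p = digitOf (sign (p ⊕ ⊝ v³))

    -- Exact orbits, their digits and the integers these spell.

    next : ℤ[τ] → ℤ[τ]
    next p = u ⊗ p ⊕ ⊝ int (digit p)

    orbit : ℤ[τ] → ℕ → ℤ[τ]
    orbit p zero    = p
    orbit p (suc n) = orbit (next p) n

    digits : ℤ[τ] → ℕ → ℤ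
    digits p i = digit (orbit p i)

    orbit-suc : ∀ p n → orbit p (suc n) ≡ next (orbit p n)
    orbit-suc p zero    = ≡.refl
    orbit-suc p (suc n) = orbit-suc (next p) n

    digit-spec : ∀ p → (digit p ≡ + 0 × Pos (p ⊕ ⊝ v³)) ⊎ (digit p ≡ + 1 × NonNeg (v³ ⊕ ⊝ p))
    digit-spec p with sign (p ⊕ ⊝ v³)
    ... | pos v³<p  = inj₁ (≡.refl , v³<p)
    ... | zero p≡v³ = inj₂ (≡.refl , inj₂ (𝒪ₚ.x≈y⇒x∙y⁻¹≈ε (≡.sym (𝒪ₚ.x∙y⁻¹≈ε⇒x≈y p v³ p≡v³))))
    ... | neg p<v³  = inj₂ (≡.refl , inj₁ (subst Pos (𝒪ₚ.⁻¹-anti-homo-// p v³) p<v³))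

    IsFloorᵒ : ℤ[τ] → ℤ → Set ℓ₂
    IsFloorᵒ p n = NonNeg (p ⊕ ⊝ int n) × Pos (int n ⊕ 𝟙 ⊕ ⊝ p)

    -- As p runs through [v, v²), the value -τp - v falls from τ towards 0 and passes 1 at v³. The
    -- upper bound 2 for digit 1 holds with slack 2 - τ = v².
    digit-isFloor : ∀ p → InDomain p → IsFloorᵒ (u ⊗ p ⊕ ⊝ v) (digit p)
    digit-isFloor p (v≤p , p<v²) with digit p | digit-spec p
    ... | _ | inj₁ (≡.refl , v³<p) =
      inj₁ (subst Pos
        (solve 1 (λ p → con τᵒ :* (con v² :- p) := con u :* p :- con v :- con 𝟘) ≡.refl p)
        (Pos-⊗ Pos-τ p<v²)) ,
      subst Pos
        (solve 1 (λ p → con τᵒ :* (p :- con v³) := con 𝟘 :+ con 𝟙 :- (con u :* p :- con v)) ≡.refl p)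
        (Pos-⊗ Pos-τ v³<p)
      where open 𝒪-Solver
    ... | _ | inj₂ (≡.refl , p≤v³) =
      subst NonNeg
        (solve 1 (λ p → con τᵒ :* (con v³ :- p) := con u :* p :- con v :- con 𝟙) ≡.refl p)
        (Pos-⊗-NonNeg Pos-τ p≤v³) ,
      subst Pos
        (solve 1 (λ p → con τᵒ :* (p :- con v) :+ con v² := con 𝟙 :+ con 𝟙 :- (con u :* p :- con v))
          ≡.refl p)
        (NonNeg-⊕-Pos (Pos-⊗-NonNeg Pos-τ v≤p) (pos! v²))
      where open 𝒪-Solver

    next-inDomain : ∀ p → InDomain p → InDomain (next p)
    next-inDomain p p∈D with digit p | digit-isFloor p p∈D
    ... | d | d≤x , x<d+1 =
      subst NonNeg
        (solve 2 (λ p d → con u :* p :- con v :- d := con u :* p :- d :- con v) ≡.refl p (int d))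
        d≤x ,
      subst Pos
        (solve 2 (λ p d → d :+ con 𝟙 :- (con u :* p :- con v) := con v² :- (con u :* p :- d))
          ≡.refl p (int d))
        x<d+1
      where open 𝒪-Solver

    orbit-inDomain : ∀ p n → InDomain p → InDomain (orbit p n)
    orbit-inDomain p zero    p∈D = p∈D
    orbit-inDomain p (suc n) p∈D = orbit-inDomain (next p) n (next-inDomain p p∈D)

    Binary : (ℕ → ℤ) → Set
    Binary d = ∀ i → d i ≡ + 0 ⊎ d i ≡ + 1

    digits-binary : ∀ p → Binary (digits p)
    digits-binary p i with digit-spec (orbit p i)
    ... | inj₁ (d≡0 , _) = inj₁ d≡0
    ... | inj₂ (d≡1 , _) = inj₂ d≡1

    horner : ℤ[τ] → (ℕ → ℤ) → ℕ → ℤ[τ]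
    horner p d zero    = p
    horner p d (suc n) = horner (u ⊗ p ⊕ int (d 0)) (d ∘ suc) n

    horner-suc : ∀ p d n → horner p d (suc n) ≡ u ⊗ horner p d n ⊕ int (d n)
    horner-suc p d zero    = ≡.refl
    horner-suc p d (suc n) = horner-suc (u ⊗ p ⊕ int (d 0)) (d ∘ suc) n

    -- Invariant of the digit loop: each step adds to the prefix the digit that it takes off the
    -- remainder.
    horner-orbit : ∀ p q n → horner p (digits q) n ⊕ orbit q n ≡ u ⊗^ n ⊗ (p ⊕ q)
    horner-orbit p q zero    = ≡.sym (𝒪.*-identityˡ _)
    horner-orbit p q (suc n) = ≡.trans
      (horner-orbit (u ⊗ p ⊕ int (digit q)) (next q) n)
      (solve 4 (λ p q d uⁿ → uⁿ :* (con u :* p :+ d :+ (con u :* q :- d)) := con u :* uⁿ :* (p :+ q))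
        ≡.refl p q (int (digit q)) (u ⊗^ n))
      where open 𝒪-Solver

    -- The end τ² is the fixed point of t ↦ t/τ + 1, so digit 1 preserves the upper bound without
    -- slack, while digit 0 leaves slack τ² - τ = 1.
    window-step : ∀ p d → d ≡ + 0 ⊎ d ≡ + 1 → Window p → Window (u ⊗ p ⊕ int d)
    window-step p d d∈01 (p'≥0 , p'<τ²) = subst (λ q → NonNeg q × Pos (τ² ⊕ ⊝ q))
      (≡.sym (≡.trans (conj-⊕ (u ⊗ p) (int d)) (cong (_⊕ conj (int d)) (conj-⊗ u p)))) (go d d∈01)
      where
      open 𝒪-Solver
      wp'≥0 : NonNeg (w ⊗ conj p)
      wp'≥0 = Pos-⊗-NonNeg Pos-τ-1 p'≥0
      go : ∀ d → d ≡ + 0 ⊎ d ≡ + 1 →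
        NonNeg (w ⊗ conj p ⊕ conj (int d)) × Pos (τ² ⊕ ⊝ (w ⊗ conj p ⊕ conj (int d)))
      go _ (inj₁ ≡.refl) = NonNeg-⊕ wp'≥0 (inj₂ ≡.refl) , subst Pos
        (solve 1 (λ p' → con w :* (con τ² :- p') :+ con 𝟙 := con τ² :- (con w :* p' :+ con 𝟘))
          ≡.refl (conj p))
        (Pos-⊕ (Pos-⊗ Pos-τ-1 p'<τ²) Pos-𝟙)
      go _ (inj₂ ≡.refl) = NonNeg-⊕ wp'≥0 (inj₁ Pos-𝟙) , subst Pos
        (solve 1 (λ p' → con w :* (con τ² :- p') := con τ² :- (con w :* p' :+ con 𝟙)) ≡.refl (conj p))
        (Pos-⊗ Pos-τ-1 p'<τ²)

    horner-window : ∀ p d n → Binary d → Window p → Window (horner p d n)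
    horner-window p d zero    d∈01 p∈W = p∈W
    horner-window p d (suc n) d∈01 p∈W =
      horner-window (u ⊗ p ⊕ int (d 0)) (d ∘ suc) n (d∈01 ∘ suc) (window-step p (d 0) (d∈01 0) p∈W)

    Window-𝟘 : Window 𝟘
    Window-𝟘 = inj₂ ≡.refl , pos! τ²

    -- If the orbit ended at v = l, the last digit would be 1 (digit 0 leads to l only from r), and
    -- the conjugate of p would be at least 1 + τ = τ².
    orbit-terminates : ∀ p q n → InDomain q → Window p → u ⊗^ suc n ⊗ q ≡ p →
      orbit q (suc n) ≡ 𝟘
    orbit-terminates p q n q∈D (p'≥0 , p'<τ²) uⁿq≡p = conclude
      (domain∩window e (orbit-inDomain q (suc n) q∈D)
        (subst Pos
          (solve 2 (λ h' e' → con τ² :- h' :+ (h' :+ e') := con τ² :+ e') ≡.refl (conj h) (conj e))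
          (subst (λ x → Pos (τ² ⊕ ⊝ conj h ⊕ x)) p'≡h'+e' (subst Pos (𝒪.+-comm (conj p) _)
            (NonNeg-⊕-Pos p'≥0 (proj₂ (window (suc n)))))))
        (subst Pos
          (solve 2 (λ h' e' → h' :+ (con τ² :- (h' :+ e')) := con τ² :- e') ≡.refl (conj h) (conj e))
          (subst (λ x → Pos (conj h ⊕ (τ² ⊕ ⊝ x))) p'≡h'+e'
            (NonNeg-⊕-Pos (proj₁ (window (suc n))) p'<τ²))))
      where
      open 𝒪-Solver
      h e : ℤ[τ]
      h = horner 𝟘 (digits q) (suc n)
      e = orbit q (suc n)
      window : ∀ n → Window (horner 𝟘 (digits q) n)
      window n = horner-window 𝟘 (digits q) n (digits-binary q) Window-𝟘
      p≡h+e : p ≡ h ⊕ e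
      p≡h+e = ≡.sym (≡.trans (horner-orbit 𝟘 q (suc n))
        (≡.trans (cong (u ⊗^ suc n ⊗_) (𝒪.+-identityˡ q)) uⁿq≡p))
      p'≡h'+e' : conj p ≡ conj h ⊕ conj e
      p'≡h'+e' = ≡.trans (cong conj p≡h+e) (conj-⊕ h e)
      g f : ℤ[τ]
      g = horner 𝟘 (digits q) n
      f = orbit q n
      e≢v : ¬ e ≡ v
      e≢v e≡v with digit-spec f
      ... | inj₁ (d≡0 , _) = ¬Pos-𝟘 (subst Pos
        (𝒪ₚ.x≈y⇒x∙y⁻¹≈ε (≡.sym f≡v²)) (proj₂ (orbit-inDomain q n q∈D)))
        where
        f≡v² : f ≡ v²
        f≡v² = ≡.trans
          (solve 1 (λ f → f := con v :* (con u :* f :- con 𝟘)) ≡.refl f)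
          (cong (v ⊗_) (≡.trans (cong (λ d → u ⊗ f ⊕ ⊝ int d) (≡.sym d≡0))
            (≡.trans (≡.sym (orbit-suc q n)) e≡v)))
      ... | inj₂ (d≡1 , _) = Pos⇒¬NonNeg-⊝ p'<τ² (subst NonNeg (≡.trans
          (solve 1 (λ g' → con w :* g' := :- (con τ² :- (con w :* g' :+ con 𝟙 :+ con τᵒ))) ≡.refl (conj g))
          (cong (λ x → ⊝ (τ² ⊕ ⊝ x)) (≡.sym p'≡)))
        (Pos-⊗-NonNeg Pos-τ-1 (proj₁ (window n))))
        where
        p'≡ : conj p ≡ w ⊗ conj g ⊕ 𝟙 ⊕ τᵒ
        p'≡ = ≡.trans p'≡h'+e' (cong₂ _⊕_
          (≡.trans (cong conj (≡.trans (horner-suc 𝟘 (digits q) n) (cong (λ d → u ⊗ g ⊕ int d) d≡1)))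
            (≡.trans (conj-⊕ (u ⊗ g) 𝟙) (cong (_⊕ 𝟙) (conj-⊗ u g))))
          (cong conj e≡v))
      conclude : e ≡ 𝟘 ⊎ e ≡ v → e ≡ 𝟘
      conclude (inj₁ e≡𝟘) = e≡𝟘
      conclude (inj₂ e≡v)  = contradiction e≡v e≢v

    -- Scaling an element into the domain.

    record ∣_∣≺_ (p s : ℤ[τ]) : Set ℓ₂ where
      constructor between
      field
        upper : Pos (s ⊕ ⊝ p)
        lower : Pos (s ⊕ p)

    ≺-⊕ : ∀ {p q s t} → ∣ p ∣≺ s → ∣ q ∣≺ t → ∣ p ⊕ q ∣≺ (s ⊕ t)
    ≺-⊕ {p} {q} {s} {t} (between p<s -s<p) (between q<t -t<q) = between
      (subst Pos (solve 4 (λ p q s t → s :- p :+ (t :- q) := s :+ t :- (p :+ q)) ≡.refl p q s t)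
        (Pos-⊕ p<s q<t))
      (subst Pos (solve 4 (λ p q s t → s :+ p :+ (t :+ q) := s :+ t :+ (p :+ q)) ≡.refl p q s t)
        (Pos-⊕ -s<p -t<q))
      where open 𝒪-Solver

    ≺-⊝ : ∀ {p s} → ∣ p ∣≺ s → ∣ ⊝ p ∣≺ s
    ≺-⊝ {p} {s} (between p<s -s<p) = between
      (subst (λ q → Pos (s ⊕ q)) (≡.sym (𝒪ₚ.-‿involutive p)) -s<p) p<s

    ≺-≤-trans : ∀ {p s t} → ∣ p ∣≺ s → NonNeg (t ⊕ ⊝ s) → ∣ p ∣≺ t
    ≺-≤-trans {p} {s} {t} (between p<s -s<p) s≤t = between
      (subst Pos (solve 3 (λ p s t → t :- s :+ (s :- p) := t :- p) ≡.refl p s t)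
        (NonNeg-⊕-Pos s≤t p<s))
      (subst Pos (solve 3 (λ p s t → t :- s :+ (s :+ p) := t :+ p) ≡.refl p s t)
        (NonNeg-⊕-Pos s≤t -s<p))
      where open 𝒪-Solver

    Bounded : ℤ[τ] → Set ℓ₂
    Bounded p = ∃[ n ] ∣ p ∣≺ int (+ n)

    Bounded-⊕ : ∀ {p q} → Bounded p → Bounded q → Bounded (p ⊕ q)
    Bounded-⊕ (m , p<m) (n , q<n) = m ℕ.+ n , ≺-⊕ p<m q<n

    Bounded-⊝ : ∀ {p} → Bounded p → Bounded (⊝ p)
    Bounded-⊝ (m , p<m) = m , ≺-⊝ p<m

    -- Bounds are strict, so the zero multiple is bounded by 1 and not by 0.
    Bounded-multiple : ∀ {p} n → Bounded p → Bounded (int (+ n) ⊗ p)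
    Bounded-multiple {p} zero    _ =
      1 , subst (∣_∣≺ 𝟙) (≡.sym (𝒪.zeroˡ p)) (between (pos! 𝟙) (pos! 𝟙))
    Bounded-multiple {p} (suc n) p-bd = subst Bounded
      (≡.sym (≡.trans (𝒪.distribʳ p 𝟙 (int (+ n))) (cong (_⊕ int (+ n) ⊗ p) (𝒪.*-identityˡ p))))
      (Bounded-⊕ p-bd (Bounded-multiple n p-bd))

    Bounded-int⊗ : ∀ {p} n → Bounded p → Bounded (int n ⊗ p)
    Bounded-int⊗ (+ n)    p-bd = Bounded-multiple n p-bd
    Bounded-int⊗ {p} -[1+ n ] p-bd = subst Bounded
      (𝒪ₚ.-‿distribˡ-* (int (+ suc n)) p) (Bounded-⊝ (Bounded-multiple (suc n) p-bd))

    -- An Archimedean property proved on pairs, from the bound 2 for both 1 and τ.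
    bounded : ∀ p → Bounded p
    bounded (a , b) = subst Bounded eq
      (Bounded-⊕ (Bounded-int⊗ a bounded-𝟙) (Bounded-int⊗ b bounded-τ))
      where
      open +-*-Solver
      bounded-𝟙 : Bounded 𝟙
      bounded-𝟙 = 2 , between (pos! (+ 1 , + 0)) (pos! (+ 3 , + 0))
      bounded-τ : Bounded τᵒ
      bounded-τ = 2 , between (pos! (+ 2 , -[1+ 0 ])) (pos! (+ 2 , + 1))
      eq : int a ⊗ 𝟙 ⊕ int b ⊗ τᵒ ≡ (a , b)
      eq = cong₂ _,_
        (solve 2 (λ a b → a :* con (+ 1) :+ con (+ 0) :+ (b :* con (+ 0) :+ con (+ 0)) := a)
          ≡.refl a b)
        (solve 2 (λ a b → a :* con (+ 0) :+ con (+ 0) :+ con (+ 0)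
          :+ (b :* con (+ 1) :+ con (+ 0) :+ con (+ 0)) := b) ≡.refl a b)

    -- A Bernoulli inequality for τ² = 1 + τ; the induction step gains nτ + (τ - 1).
    1+n≤τ²ⁿ : ∀ n → NonNeg (τ² ⊗^ n ⊕ ⊝ int (+ suc n))
    1+n≤τ²ⁿ zero    = inj₂ ≡.refl
    1+n≤τ²ⁿ (suc n) = subst NonNeg
      (solve 2 (λ x n → con τ² :* (x :- (con 𝟙 :+ n)) :+ (n :* con τᵒ :+ con w) :=
        con τ² :* x :- (con 𝟙 :+ (con 𝟙 :+ n))) ≡.refl (τ² ⊗^ n) (int (+ n)))
      (NonNeg-⊕ (Pos-⊗-NonNeg (pos! τ²) (1+n≤τ²ⁿ n))
        (NonNeg-⊕ (NonNeg-multiple n (inj₁ Pos-τ)) (inj₁ Pos-τ-1)))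
      where open 𝒪-Solver

    -- Since u² = τ² is positive, shifting by two places keeps the sign and hence a symmetric bound.
    -- Written `n ℕ.* 2`, the exponent unfolds by two in each step.
    shrink : ∀ n p s → ∣ p ∣≺ (τ² ⊗^ n ⊗ s) → ∃[ q ] (∣ q ∣≺ s × u ⊗^ (n ℕ.* 2) ⊗ q ≡ p)
    shrink zero    p s p<s = p , subst (∣ p ∣≺_) (𝒪.*-identityˡ s) p<s , 𝒪.*-identityˡ p
    shrink (suc n) p s (between p<τ²s -τ²s<p) =
      proj₁ ih , proj₁ (proj₂ ih) , u²u²ⁿq≡p (proj₁ ih) (proj₂ (proj₂ ih))
      where
      open 𝒪-Solver
      v²p<s : ∣ v² ⊗ p ∣≺ (τ² ⊗^ n ⊗ s)
      v²p<s = between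
        (subst Pos (solve 3 (λ x s p → con v² :* (con τ² :* x :* s :- p) := x :* s :- con v² :* p)
          ≡.refl (τ² ⊗^ n) s p) (Pos-⊗ (pos! v²) p<τ²s))
        (subst Pos (solve 3 (λ x s p → con v² :* (con τ² :* x :* s :+ p) := x :* s :+ con v² :* p)
          ≡.refl (τ² ⊗^ n) s p) (Pos-⊗ (pos! v²) -τ²s<p))
      ih : ∃[ q ] (∣ q ∣≺ s × u ⊗^ (n ℕ.* 2) ⊗ q ≡ v² ⊗ p)
      ih = shrink n (v² ⊗ p) s v²p<s
      u²u²ⁿq≡p : ∀ q → u ⊗^ (n ℕ.* 2) ⊗ q ≡ v² ⊗ p → u ⊗^ (suc n ℕ.* 2) ⊗ q ≡ p
      u²u²ⁿq≡p q eq = ≡.trans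
        (solve 2 (λ x q → con u :* (con u :* x) :* q := con τ² :* (x :* q))
          ≡.refl (u ⊗^ (n ℕ.* 2)) q)
        (≡.trans (cong (τ² ⊗_) eq)
          (solve 1 (λ p → con τ² :* (con v² :* p) := p) ≡.refl p))

    -- One division beyond m absorbs the radius v²: (τ²)^(m+1) v² = (τ²)^m ≥ 1 + m. The exponent is
    -- a successor because the leading digit will stand at position n.
    shift-into-domain : ∀ p → ∃[ n ] ∃[ q ] (∣ q ∣≺ v² × u ⊗^ suc n ⊗ q ≡ p)
    shift-into-domain p = suc (m ℕ.* 2) , shrink (suc m) p v² (≺-≤-trans p<m m≤τ²ᵐ)
      where
      open 𝒪-Solver
      m : ℕ
      m = proj₁ (bounded p)
      p<m : ∣ p ∣≺ int (+ m)
      p<m = proj₂ (bounded p)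
      m≤τ²ᵐ : NonNeg (τ² ⊗^ suc m ⊗ v² ⊕ ⊝ int (+ m))
      m≤τ²ᵐ = subst NonNeg
        (solve 2 (λ x m → x :- (con 𝟙 :+ m) :+ con 𝟙 := con τ² :* x :* con v² :- m)
          ≡.refl (τ² ⊗^ m) (int (+ m)))
        (NonNeg-⊕ (1+n≤τ²ⁿ m) (inj₁ Pos-𝟙))

module GoldenIntegers {c ℓ₁ ℓ₂} (ℝ : Reals c ℓ₁ ℓ₂) (τ : Reals.Carrier ℝ)
  (1<τ : Reals._<_ ℝ (Reals.1# ℝ) τ)
  (τ²≈1+τ : Reals._≈_ ℝ (Reals._*_ ℝ τ τ) (Reals._+_ ℝ (Reals.1# ℝ) τ)) where
  open Reals ℝ hiding (zero)
  open RealProperties ℝ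
  open MinusBeta ℝ τ 1<τ
  open GoldenEmbedding ℝ τ 1<τ τ²≈1+τ
  private
    module R = CommutativeRing commutativeRing
  open SetoidReasoning setoid

  -- The constants of the expansion as values of `φ`.

  inv-unique : ∀ x y (0<x : 0# < x) → x * y ≈ 1# → inv x 0<x ≈ y
  inv-unique x y 0<x xy≈1 = begin
    inv x 0<x            ≈⟨ *-identityʳ _ ⟨
    inv x 0<x * 1#       ≈⟨ *-congˡ xy≈1 ⟨
    inv x 0<x * (x * y)  ≈⟨ *-assoc _ _ _ ⟨
    inv x 0<x * x * y    ≈⟨ *-congʳ (trans (*-comm _ _) (inv-inverseʳ x 0<x)) ⟩
    1# * y               ≈⟨ *-identityˡ y ⟩
    y                    ∎

  φ-u : φ u ≈ - τ
  φ-u = trans (φ-⊝ τᵒ) (-‿cong φ-τ)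

  -inv-τ≈φ-v : - inv τ 0<β ≈ φ v
  -inv-τ≈φ-v = trans
    (-‿cong (inv-unique τ (φ w) 0<β (trans (*-congʳ (sym φ-τ)) (trans (sym (φ-⊗ τᵒ w)) φ-𝟙))))
    (sym (φ-⊝ w))

  l≈φ-v : l ≈ φ v
  l≈φ-v = trans
    (-‿cong (trans (*-cong (sym φ-τ) (inv-unique (τ + 1#) (φ v²) _ (begin
      (τ + 1#) * φ v²         ≈⟨ *-congʳ (+-cong φ-τ φ-𝟙) ⟨
      (φ τᵒ + φ 𝟙) * φ v²     ≈⟨ *-congʳ (φ-⊕ τᵒ 𝟙) ⟨
      φ τ² * φ v²             ≈⟨ φ-⊗ τ² v² ⟨
      φ 𝟙                     ≈⟨ φ-𝟙 ⟩
      1#                      ∎)))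
      (sym (φ-⊗ τᵒ v²))))
    (sym (φ-⊝ w))

  r≈φ-v² : r ≈ φ v²
  r≈φ-v² = trans (+-cong (sym φ-𝟙) l≈φ-v) (sym (φ-⊕ 𝟙 v))

  -β^-neg≈φ-v^ : ∀ n → -β^ (-[1+ n ]) ≈ φ (v ⊗^ suc n)
  -β^-neg≈φ-v^ n = trans (^-congˡ (suc n) -inv-τ≈φ-v) (sym (φ-^ v (suc n)))
    where open SemiringExp R.semiring using (^-congˡ)

  -- Partial sums and limits of eventually constant sequences.

  sum-zero : ∀ {n} (f : Fin n → Carrier) → (∀ i → f i ≈ 0#) → sum f ≈ 0#
  sum-zero {zero}  f f≈0 = refl
  sum-zero {suc n} f f≈0 =
    trans (+-cong (f≈0 zero) (sum-zero (λ i → f (suc i)) (λ i → f≈0 (suc i)))) (+-identityˡ 0#)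

  -- The accumulator p is the value of the digits already read, in units of (-τ)^K; K positions
  -- remain down to the units, and the n terms after them vanish.
  sum-horner : ∀ K n p d (f : Fin (K ℕ.+ n) → Carrier) →
    (∀ j → f j ≈ fromℤ (d (toℕ j)) * -β^ (K ⊖ suc (toℕ j))) →
    (∀ j → d (K ℕ.+ j) ≡ + 0) →
    φ p * (- τ) ^ K + sum f ≈ φ (horner p d K)
  sum-horner zero n p d f f≈ d≡0 = trans
    (+-cong (*-identityʳ _) (sum-zero f λ j →
      trans (f≈ j) (trans (*-congʳ (reflexive (cong fromℤ (d≡0 (toℕ j))))) (zeroˡ _))))
    (+-identityʳ _)
  sum-horner (suc K) n p d f f≈ d≡0 = begin
    φ p * (- τ * x) + (f zero + s)
      ≈⟨ +-cong (*-congˡ (*-congʳ (sym φ-u)))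
           (+-congʳ (trans (f≈ zero) (*-congʳ (sym (φ-int (d 0)))))) ⟩
    φ p * (φ u * x) + (φ (int (d 0)) * x + s)
      ≈⟨ solve 5 (λ p u d x s → p :* (u :* x) :+ (d :* x :+ s) := (u :* p :+ d) :* x :+ s)
           refl (φ p) (φ u) (φ (int (d 0))) x s ⟩
    (φ u * φ p + φ (int (d 0))) * x + s
      ≈⟨ +-congʳ (*-congʳ (trans (φ-⊕ (u ⊗ p) (int (d 0))) (+-congʳ (φ-⊗ u p)))) ⟨
    φ (u ⊗ p ⊕ int (d 0)) * x + s
      ≈⟨ sum-horner K n (u ⊗ p ⊕ int (d 0)) (d ∘ suc) (λ j → f (suc j))
           (λ j → trans (f≈ (suc j))
             (*-congˡ (reflexive (cong -β^_ ([1+m]⊖[1+n]≡m⊖n K (suc (toℕ j)))))))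
           d≡0 ⟩
    φ (horner p d (suc K)) ∎
    where
    open SemiringSolver commutativeSemiring
    x s : Carrier
    x = (- τ) ^ K
    s = sum (λ j → f (suc j))

  eventually-constant : ∀ {a x} K → (∀ n → a (K ℕ.+ n) ≈ x) → a ConvergesTo x
  eventually-constant {a} {x} K a≈x ε 0<ε = K , λ n K≤n →
    let an≈x  = trans (reflexive (cong a (≡.sym (ℕₚ.m+[n∸m]≡n K≤n)))) (a≈x (n ℕ.∸ K))
        a-x≈0 = trans (+-congʳ an≈x) (-‿inverseʳ x)
        -ε<0  = <-respʳ-≈ (-‿inverseʳ ε) (<-respˡ-≈ (+-identityˡ _) (+-monoˡ-< (- ε) 0<ε))
    in <-respʳ-≈ (sym a-x≈0) -ε<0 , <-respˡ-≈ (sym a-x≈0) 0<ε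

  -- Equality comes from tightness of apartness: if x and y were apart, their distance would be an ε
  -- that the limit contradicts.
  limit-eventually-constant : ∀ {a x y} K → a ConvergesTo x → (∀ n → a (K ℕ.+ n) ≈ y) → x ≈ y
  limit-eventually-constant {a} {x} {y} K a→x a≈y = proj₁ (tight x y) x≮≯y
    where
    within : ∀ ε → 0# < ε → ∣ y - x ∣< ε
    within ε 0<ε with a→x ε 0<ε
    ... | N , close with close (K ℕ.+ N) (ℕₚ.m≤n+m N K)
    ... | -ε< , <ε = <-respʳ-≈ (+-congʳ (a≈y N)) -ε< , <-respˡ-≈ (+-congʳ (a≈y N)) <ε
    x≮≯y : ¬ x # y
    x≮≯y x#y with #⇒<⊎> x#y
    ... | inj₁ x<y = <-irrefl refl (proj₂ (within (y - x) (<⇒pos x<y)))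
    ... | inj₂ y<x = <-irrefl -x-y≈y-x (proj₁ (within (x - y) (<⇒pos y<x)))
      where
      -x-y≈y-x : - (x - y) ≈ y - x
      -x-y≈y-x = RingProperties.⁻¹-anti-homo-// R.ring x y

  -- As `_≤_` is only a negation, cotransitivity of apartness has to produce the strict comparison.
  ≤-<-trans : ∀ {x y z} → x ≤ y → y < z → x < z
  ≤-<-trans {x} {y} {z} x≤y y<z with #-cotrans (<⇒# y<z) x
  ... | inj₁ y#x with #⇒<⊎> y#x
  ...   | inj₁ y<x = contradiction y<x x≤y
  ...   | inj₂ x<y = <-trans x<y y<z
  ≤-<-trans {x} {y} {z} x≤y y<z | inj₂ x#z with #⇒<⊎> x#z
  ...   | inj₁ x<z = x<z
  ...   | inj₂ z<x = contradiction (<-trans y<z z<x) x≤y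

  -- Every (-τ)-integer is the image of a window element.

  InDomainℝ : Carrier → Set ℓ₂
  InDomainℝ t = l ≤ t × t < r

  <r⇒0<-τt-l : ∀ {t} → t < r → 0# < - τ * t - l
  <r⇒0<-τt-l {t} t<r = <-respʳ-≈
    (trans (solve 1 (λ t → con τᵒ :* (con v² :- t) := con u :* t :- con v) refl t)
      (+-cong (*-congʳ φ-u) (-‿cong (sym l≈φ-v))))
    (*-pos (0<φ Pos-τ) (<⇒pos (<-respʳ-≈ r≈φ-v² t<r)))
    where open ℝ-Solver

  -- On [l, r) the value -τt - l lies in (0, τ], and τ < 2.
  floor-binary : ∀ t n → InDomainℝ t → IsFloor (- τ * t - l) n → n ≡ + 0 ⊎ n ≡ + 1
  floor-binary t (+ 0) _ _ = inj₁ ≡.refl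
  floor-binary t (+ 1) _ _ = inj₂ ≡.refl
  floor-binary t (+ suc (suc m)) (l≤t , _) (2+m≤x , _) =
    contradiction (≤-<-trans x≤τ τ<2+m) 2+m≤x
    where
    x≈ : - τ * t - l ≈ φ u * t - φ v
    x≈ = +-cong (*-congʳ (sym φ-u)) (-‿cong l≈φ-v)
    x≤τ : - τ * t - l ≤ φ τᵒ
    x≤τ τ<x = l≤t (pos⇒< (<-respʳ-≈
      (trans (solve 1 (λ t → con w :* (con u :* t :- con v :- con τᵒ) := con v :- t) refl t)
        (+-congʳ (sym l≈φ-v)))
      (*-pos (0<φ Pos-τ-1) (<⇒pos (<-respʳ-≈ x≈ τ<x)))))
      where open ℝ-Solver
    τ<2+m : φ τᵒ < fromℤ (+ suc (suc m))
    τ<2+m = pos⇒< (<-respʳ-≈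
      (trans (φ-⊕ (int (+ suc (suc m))) (⊝ τᵒ)) (+-cong (φ-int (+ suc (suc m))) (φ-⊝ τᵒ)))
      (0<φ (subst Pos
        (solve 1 (λ m → m :* con 𝟙 :+ con v² := con 𝟙 :+ (con 𝟙 :+ m) :- con τᵒ) ≡.refl (int (+ m)))
        (NonNeg-⊕-Pos (NonNeg-multiple m (inj₁ Pos-𝟙)) (pos! v²)))))
      where open 𝒪-Solver
  floor-binary t -[1+ m ] (_ , t<r) (_ , x<-m) = impossible 𝟘 (⊝ 𝟙) m
    (cong₂ _,_
      (solve 1 (λ m → :- (con (+ 1) :+ m) :+ con (+ 1) :=
        con (+ 0) :+ (m :* con -[1+ 0 ] :+ con (+ 0))) ≡.refl (+ m))
      (solve 1 (λ m → con (+ 0) := con (+ 0) :+ (m :* con (+ 0) :+ con (+ 0) :+ con (+ 0)))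
        ≡.refl (+ m)))
    (mkPos (<-respʳ-≈
      (sym (trans (φ-⊕ (int -[1+ m ]) 𝟙) (+-cong (φ-int -[1+ m ]) φ-𝟙)))
      (<-trans (<r⇒0<-τt-l t<r) x<-m)))
    where
    open +-*-Solver

  -- The difference z - l is the fractional part of -τt - l, hence in [0, 1).
  T-inDomain : ∀ {t z} → T t z → InDomainℝ z
  T-inDomain {t} {z} (n , (n≤x , x<n+1) , z≈) =
      (λ z<l → n≤x (pos⇒< (<-respʳ-≈
        (trans (+-congˡ (-‿cong z≈))
          (solve 3 (λ l x n → l :- (x :- n) := n :- (x :- l)) refl l (- τ * t) (fromℤ n)))
        (<⇒pos z<l))))
    , pos⇒< (<-respʳ-≈
        (trans (solve 4 (λ o l x n → n :+ o :- (x :- l) := o :+ l :- (x :- n))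
            refl 1# l (- τ * t) (fromℤ n))
          (+-congˡ (-‿cong (sym z≈))))
        (<⇒pos x<n+1))
    where open ℝ-Solver

  isDigitString-binary : ∀ {y d} → IsDigitString y d → Binary d
  isDigitString-binary {d = d} ds i = floor-binary (D.t i) (d i) (t-inDomain i) (D.digit i)
    where
    module D = IsDigitString ds
    t-inDomain : ∀ i → InDomainℝ (D.t i)
    t-inDomain zero    = (λ t<l → D.l≤y (<-respˡ-≈ D.start t<l)) , <-respˡ-≈ (sym D.start) D.y<r
    t-inDomain (suc i) = T-inDomain (D.step i)

  ℤ₋β⇒window : ∀ {x} → ℤ₋β x → ∃[ p ] (Window p × x ≈ φ p)
  ℤ₋β⇒window {x} (e , fraction≡0) = go k ≡.refl
    where
    open Expansion e
    open IsRepresentation isRepresentation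
    go : ∀ k′ → k ≡ k′ → ∃[ p ] (Window p × x ≈ φ p)
    -- Positions K down to 0 take `suc K` terms; all later terms are zero, so the limit is the
    -- Horner value.
    go (+ K) ≡.refl = horner 𝟘 d (suc K) ,
      horner-window 𝟘 d (suc K) (isDigitString-binary isDigitString) Window-𝟘 ,
      limit-eventually-constant (suc K) converges λ n →
        trans (sym (trans (+-congʳ (trans (*-congʳ φ-𝟘) (zeroˡ _))) (+-identityˡ _)))
          (sum-horner (suc K) n 𝟘 d (λ j → fromℤ (xs (+ K ℤ.- + toℕ j)) * -β^ (+ K ℤ.- + toℕ j))
            (λ j → *-congˡ (reflexive (cong -β^_ (≡.trans (m-n≡m⊖n K (toℕ j))
              (≡.sym ([1+m]⊖[1+n]≡m⊖n K (toℕ j)))))))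
            (λ j → fraction≡0 _ (subst (ℤ._< + 0) (≡.sym (K-[1+K+j] j)) ℤ.-<+)))
      where
      d : ℕ → ℤ
      d j = xs (+ K ℤ.- + j)
      K-[1+K+j] : ∀ j → + K ℤ.- + (suc K ℕ.+ j) ≡ -[1+ j ]
      K-[1+K+j] j = solve 2 (λ k j → k :- (con (+ 1) :+ k :+ j) := :- (con (+ 1) :+ j)) ≡.refl (+ K) (+ j)
        where open +-*-Solver
    -- With a negative leading position every digit is fractional, hence zero, and x is 0.
    go -[1+ m ] ≡.refl = 𝟘 , Window-𝟘 ,
      limit-eventually-constant 0 converges λ n → trans
        (sum-zero (λ (j : Fin n) → fromℤ (xs (-[1+ m ] ℤ.- + toℕ j)) * -β^ (-[1+ m ] ℤ.- + toℕ j)) λ j →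
          trans (*-congʳ (reflexive (cong fromℤ (fraction≡0 _
            (subst (ℤ._< + 0) (≡.sym (-[1+m]-j (toℕ j))) ℤ.-<+))))) (zeroˡ _))
        (sym φ-𝟘)
      where
      -[1+m]-j : ∀ j → -[1+ m ] ℤ.- + j ≡ -[1+ m ℕ.+ j ]
      -[1+m]-j j = solve 2 (λ m j → :- (con (+ 1) :+ m) :- j := :- (con (+ 1) :+ (m :+ j)))
        ≡.refl (+ m) (+ j)
        where open +-*-Solver

  -- Every window element is a (-τ)-integer.

  φ-isFloor : ∀ p n → IsFloorᵒ (u ⊗ p ⊕ ⊝ v) n → IsFloor (- τ * φ p - l) n
  φ-isFloor p n (n≤x , x<n+1) =
      (λ x<n → Pos⇒¬NonNeg-⊝ {⊝ (x ⊕ ⊝ int n)}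
        (mkPos (<-respʳ-≈ (trans (+-cong (sym (φ-int n)) (-‿cong X≈))
            (trans (trans (+-congˡ (sym (φ-⊝ x))) (sym (φ-⊕ (int n) (⊝ x))))
              (reflexive (cong φ (≡.sym (𝒪ₚ.⁻¹-anti-homo-// x (int n)))))))
          (<⇒pos x<n)))
        (subst NonNeg (≡.sym (𝒪ₚ.-‿involutive (x ⊕ ⊝ int n))) n≤x))
    , pos⇒< (<-respʳ-≈
        (trans (φ-⊕ (int n ⊕ 𝟙) (⊝ x))
          (+-cong (trans (φ-⊕ (int n) 𝟙) (+-cong (φ-int n) φ-𝟙)) (trans (φ-⊝ x) (-‿cong (sym X≈)))))
        (0<φ x<n+1))
    where
    x : ℤ[τ]
    x = u ⊗ p ⊕ ⊝ v
    X≈ : - τ * φ p - l ≈ φ x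
    X≈ = sym (trans (φ-⊕ (u ⊗ p) (⊝ v))
      (+-cong (trans (φ-⊗ u p) (*-congʳ φ-u)) (trans (φ-⊝ v) (-‿cong (sym l≈φ-v)))))

  φ-T : ∀ p → InDomain p → T (φ p) (φ (next p))
  φ-T p p∈D = digit p , φ-isFloor p (digit p) (digit-isFloor p p∈D) ,
    trans (φ-⊕ (u ⊗ p) (⊝ int (digit p)))
      (+-cong (trans (φ-⊗ u p) (*-congʳ φ-u)) (trans (φ-⊝ (int (digit p))) (-‿cong (φ-int (digit p)))))

  digits-isDigitString : ∀ p → InDomain p → IsDigitString (φ p) (digits p)
  digits-isDigitString p p∈D@(v≤p , p<v²) = record
    { l≤y   = λ p<l → Pos⇒¬NonNeg-⊝ {v ⊕ ⊝ p}
        (mkPos (<-respʳ-≈ (trans (+-cong l≈φ-v (sym (φ-⊝ p))) (sym (φ-⊕ v (⊝ p)))) (<⇒pos p<l)))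
        (subst NonNeg (≡.sym (𝒪ₚ.⁻¹-anti-homo-// v p)) v≤p)
    ; y<r   = φ<r p p<v²
    ; t     = λ i → φ (orbit p i)
    ; start = refl
    ; step  = λ i → subst (λ q → T (φ (orbit p i)) (φ q)) (≡.sym (orbit-suc p i))
        (φ-T (orbit p i) (orbit-inDomain p i p∈D))
    ; digit = λ i → φ-isFloor (orbit p i) (digits p i)
        (digit-isFloor (orbit p i) (orbit-inDomain p i p∈D))
    }
    where
    φ<r : ∀ p → Pos (v² ⊕ ⊝ p) → φ p < r
    φ<r p p<v² = pos⇒< (<-respʳ-≈
      (trans (φ-⊕ v² (⊝ p)) (+-cong (sym r≈φ-v²) (φ-⊝ p))) (0<φ p<v²))

  orbit-𝟘 : ∀ n → orbit 𝟘 n ≡ 𝟘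
  orbit-𝟘 zero    = ≡.refl
  orbit-𝟘 (suc n) = orbit-𝟘 n

  orbit-+ : ∀ p m n → orbit p (m ℕ.+ n) ≡ orbit (orbit p m) n
  orbit-+ p zero    n = ≡.refl
  orbit-+ p (suc m) n = orbit-+ (next p) m n

  shifted⇒ℤ₋β : ∀ p n q → Window p → ∣ q ∣≺ v² → u ⊗^ suc n ⊗ q ≡ p → ℤ₋β (φ p)
  shifted⇒ℤ₋β p n q p∈W (between q<v² -v²<q) uⁿq≡p = expansion , fraction≡0
    where
    v<q : Pos (q ⊕ ⊝ v)
    v<q = subst Pos
      -- The added constant 2τ - 3 is -v³ > 0: since -v = v² - v³, the left end of the domain lies
      -- beyond -v².
      (solve 1 (λ q → con v² :+ q :+ con (-[1+ 2 ] , + 2) := q :- con v) ≡.refl q)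
      (Pos-⊕ -v²<q (pos! (-[1+ 2 ] , + 2)))
      where open 𝒪-Solver
    q∈D : InDomain q
    q∈D = inj₁ v<q , q<v²
    d : ℤ → ℤ
    d (+ j)    = digits q j
    -- Negative indices are the positions above n, where the representation must be zero.
    d -[1+ _ ] = + 0
    xs : ℤ → ℤ
    xs i = d (+ n ℤ.- i)
    terminates : orbit q (suc n) ≡ 𝟘
    terminates = orbit-terminates p q n q∈D p∈W uⁿq≡p
    digits≡0 : ∀ j → digits q (suc n ℕ.+ j) ≡ + 0
    digits≡0 j = cong digit
      (≡.trans (orbit-+ q (suc n) j) (≡.trans (cong (λ q → orbit q j) terminates) (orbit-𝟘 j)))
    xs-n-j : ∀ j → xs (+ n ℤ.- + j) ≡ digits q j
    xs-n-j j = cong d (solve 2 (λ n j → n :- (n :- j) := j) ≡.refl (+ n) (+ j))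
      where open +-*-Solver
    horner≡p : horner 𝟘 (digits q) (suc n) ≡ p
    horner≡p = ≡.trans (≡.sym (𝒪.+-identityʳ _))
      (≡.trans (cong (horner 𝟘 (digits q) (suc n) ⊕_) (≡.sym terminates))
        (≡.trans (horner-orbit 𝟘 q (suc n))
          (≡.trans (cong (u ⊗^ suc n ⊗_) (𝒪.+-identityˡ q)) uⁿq≡p)))
    fraction≡0 : ∀ i → i ℤ.< + 0 → xs i ≡ + 0
    fraction≡0 -[1+ m ] _ = ≡.trans (cong (digits q) (ℕₚ.+-suc n m)) (digits≡0 m)
    fraction≡0 (+ m) (ℤ.+<+ ())
    zero-above : ∀ i → + n ℤ.< i → xs i ≡ + 0
    zero-above i n<i with + n ℤ.- i
                        | subst (+ n ℤ.- i ℤ.<_) (ℤₚ.+-inverseʳ i) (ℤₚ.+-monoˡ-< (ℤ.- i) n<i)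
    ... | -[1+ _ ] | _ = ≡.refl
    ... | + _      | ℤ.+<+ ()
    expansion : Expansion (φ p)
    expansion = record
      { k = + n
      ; xs = xs
      ; isRepresentation = record
        { zero-above = zero-above
        ; converges = eventually-constant (suc n) λ m →
            trans (sym (trans (+-congʳ (trans (*-congʳ φ-𝟘) (zeroˡ _))) (+-identityˡ _)))
              (trans
                (sum-horner (suc n) m 𝟘 (digits q)
                  (λ j → fromℤ (xs (+ n ℤ.- + toℕ j)) * -β^ (+ n ℤ.- + toℕ j))
                  (λ j → *-cong (reflexive (cong fromℤ (xs-n-j (toℕ j))))
                    (reflexive (cong -β^_ (≡.trans (m-n≡m⊖n n (toℕ j))
                      (≡.sym ([1+m]⊖[1+n]≡m⊖n n (toℕ j)))))))
                  digits≡0)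
                (reflexive (cong φ horner≡p)))
        }
      ; y = φ q
      ; l<y = pos⇒< (<-respʳ-≈
          (trans (φ-⊕ q (⊝ v)) (+-congˡ (trans (φ-⊝ v) (-‿cong (sym l≈φ-v))))) (0<φ v<q))
      ; y<r = D.y<r
      -- Rebuilt because the two digit sequences agree only pointwise.
      ; isDigitString = record
        { l≤y = D.l≤y ; y<r = D.y<r ; t = D.t ; start = D.start ; step = D.step
        ; digit = λ i → subst (IsFloor (- τ * D.t i - l)) (≡.sym (xs-n-j i)) (D.digit i)
        }
      }
      where module D = IsDigitString (digits-isDigitString q q∈D)

  window⇒ℤ₋β : ∀ p → Window p → ℤ₋β (φ p)
  window⇒ℤ₋β p p∈W =
    let n , q , q<v² , uⁿq≡p = shift-into-domain p in shifted⇒ℤ₋β p n q p∈W q<v² uⁿq≡p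

  -- Two fractional digits suffice.

  window-τ²⊗ : ∀ s → NonNeg (conj s) → Pos (τ² ⊗ τ² ⊕ ⊝ conj s) → Window (τ² ⊗ s)
  window-τ²⊗ s s'≥0 s'<τ⁴ = subst (λ q → NonNeg q × Pos (τ² ⊕ ⊝ q)) (≡.sym (conj-⊗ τ² s))
    ( Pos-⊗-NonNeg (pos! v²) s'≥0
    , subst Pos
        (solve 1 (λ s' → con v² :* (con (τ² ⊗ τ²) :- s') := con τ² :- con v² :* s') ≡.refl (conj s))
        (Pos-⊗ (pos! v²) s'<τ⁴))
    where open 𝒪-Solver

  two-fractional-digits : ∀ {x} s → x ≈ φ s → Window (τ² ⊗ s) → x ∈-β^ ℤ.- + 2 ℤ₋β
  two-fractional-digits {x} s x≈φs τ²s∈W = φ (τ² ⊗ s) , window⇒ℤ₋β (τ² ⊗ s) τ²s∈W , (begin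
    x                         ≈⟨ x≈φs ⟩
    φ s                       ≡⟨ cong φ (solve 1 (λ s → s := con v² :* (con τ² :* s)) ≡.refl s) ⟩
    φ (v² ⊗ (τ² ⊗ s))         ≈⟨ φ-⊗ v² (τ² ⊗ s) ⟩
    φ v² * φ (τ² ⊗ s)         ≈⟨ *-congʳ (-β^-neg≈φ-v^ 1) ⟨
    -β^ -[1+ 1 ] * φ (τ² ⊗ s) ∎)
    where open 𝒪-Solver

  ⊕-digits : BoundsFractionalDigits _+_ 2
  ⊕-digits x y x∈ y∈ _ with ℤ₋β⇒window x∈ | ℤ₋β⇒window y∈
  ... | p , (p'≥0 , p'<τ²) , x≈φp | q , (q'≥0 , q'<τ²) , y≈φq =
    two-fractional-digits (p ⊕ q) (trans (+-cong x≈φp y≈φq) (sym (φ-⊕ p q)))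
      (window-τ²⊗ (p ⊕ q)
        (subst NonNeg (≡.sym (conj-⊕ p q)) (NonNeg-⊕ p'≥0 q'≥0))
        (subst (λ s → Pos (τ² ⊗ τ² ⊕ ⊝ s)) (≡.sym (conj-⊕ p q)) (subst Pos
          -- The slack is τ⁴ - 2τ² = τ.
          (solve 2 (λ p' q' → con τ² :- p' :+ (con τ² :- q') :+ con τᵒ :=
            con (τ² ⊗ τ²) :- (p' :+ q')) ≡.refl (conj p) (conj q))
          (Pos-⊕ (Pos-⊕ p'<τ² q'<τ²) Pos-τ))))
    where open 𝒪-Solver

  ⊗-digits : BoundsFractionalDigits _*_ 2
  ⊗-digits x y x∈ y∈ _ with ℤ₋β⇒window x∈ | ℤ₋β⇒window y∈
  ... | p , (p'≥0 , p'<τ²) , x≈φp | q , (q'≥0 , q'<τ²) , y≈φq =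
    two-fractional-digits (p ⊗ q) (trans (*-cong x≈φp y≈φq) (sym (φ-⊗ p q)))
      (window-τ²⊗ (p ⊗ q)
        (subst NonNeg (≡.sym (conj-⊗ p q)) (NonNeg-⊗ p'≥0 q'≥0))
        (subst (λ s → Pos (τ² ⊗ τ² ⊕ ⊝ s)) (≡.sym (conj-⊗ p q)) (subst Pos
          (solve 2 (λ p' q' → p' :* (con τ² :- q') :+ con τ² :* (con τ² :- p') :=
            con (τ² ⊗ τ²) :- p' :* q') ≡.refl (conj p) (conj q))
          (NonNeg-⊕-Pos (NonNeg-⊗ p'≥0 (inj₁ q'<τ²)) (Pos-⊗ (pos! τ²) p'<τ²)))))
    where
    open 𝒪-Solver
    NonNeg-⊗ : ∀ {p q} → NonNeg p → NonNeg q → NonNeg (p ⊗ q)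
    NonNeg-⊗ (inj₁ 0<p) q≥0 = Pos-⊗-NonNeg 0<p q≥0
    NonNeg-⊗ {q = q} (inj₂ ≡.refl) _ = inj₂ (𝒪.zeroˡ q)

  -- Fewer than two fractional digits do not suffice.

  -√5 : ℤ[τ]
  -√5 = + 1 , -[1+ 1 ]

  -√5∈ℤ₋β : ℤ₋β (φ -√5)
  -√5∈ℤ₋β = window⇒ℤ₋β -√5 (nonNeg! (conj -√5) , pos! (τ² ⊕ ⊝ conj -√5))

  -- Injectivity of `φ` identifies s with the window element found for the (-τ)-integer, so a failed
  -- window test refutes membership.
  integer-window : ∀ {x} s → x ≈ φ s → x ∈-β^ + 0 ℤ₋β → Window s
  integer-window s x≈φs (z , z∈ , x≈z) with ℤ₋β⇒window z∈
  ... | q , q∈W , z≈φq = subst Window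
    (φ-injective q s (trans (sym z≈φq) (trans (sym (trans x≈z (*-identityˡ z))) x≈φs))) q∈W

  one-digit-window : ∀ {x} s → x ≈ φ s → x ∈-β^ -[1+ 0 ] ℤ₋β → Window (u ⊗ s)
  one-digit-window {x} s x≈φs (z , z∈ , x≈v*z) with ℤ₋β⇒window z∈
  ... | q , q∈W , z≈φq = subst Window
    (≡.trans (solve 1 (λ q → q := con u :* (con v :* q)) ≡.refl q)
      (cong (u ⊗_) (φ-injective (v ⊗ q) s (begin
        φ (v ⊗ q)        ≈⟨ φ-⊗ v q ⟩
        φ v * φ q        ≈⟨ *-cong (-β^-neg≈φ-v^ 0) z≈φq ⟨
        -β^ -[1+ 0 ] * z ≈⟨ x≈v*z ⟨
        x                ≈⟨ x≈φs ⟩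
        φ s              ∎)))) q∈W
    where open 𝒪-Solver

  -- The window test for `τ² ⊗ s` also supplies membership in Fin, so `bound` applies; n = 0 or 1
  -- would then put s or `u ⊗ s` in the window.
  at-least-two : ∀ {_∙_} s → φ -√5 ∙ φ -√5 ≈ φ s →
    ¬ Window s → ¬ Window (u ⊗ s) → Window (τ² ⊗ s) →
    ∀ n → BoundsFractionalDigits _∙_ n → 2 ℕ.≤ n
  at-least-two {_∙_} s x≈φs s∉W us∉W τ²s∈W n bound = go n
    (bound _ _ -√5∈ℤ₋β -√5∈ℤ₋β (ℤ.- + 2 , two-fractional-digits s x≈φs τ²s∈W))
    where
    go : ∀ n → (φ -√5 ∙ φ -√5) ∈-β^ ℤ.- + n ℤ₋β → 2 ℕ.≤ n
    go 0 x∈ = contradiction (integer-window s x≈φs x∈) s∉W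
    go 1 x∈ = contradiction (one-digit-window s x≈φs x∈) us∉W
    go (suc (suc n)) _ = ℕ.s≤s (ℕ.s≤s ℕ.z≤n)

  ¬Window! : ∀ p → {IsNonNeg (sign (conj p ⊕ ⊝ τ²))} → ¬ Window p
  ¬Window! p {s} (_ , p'<τ²) = Pos⇒¬NonNeg-⊝ p'<τ²
    (subst NonNeg (≡.sym (𝒪ₚ.⁻¹-anti-homo-// τ² (conj p))) (nonNeg! (conj p ⊕ ⊝ τ²) {s}))

  window! : ∀ p → {IsNonNeg (sign (conj p))} → {IsPos (sign (τ² ⊕ ⊝ conj p))} → Window p
  window! p {s} {t} = nonNeg! (conj p) {s} , pos! (τ² ⊕ ⊝ conj p) {t}

  L⊕≡2 : L⊕≡ 2
  L⊕≡2 = ⊕-digits , at-least-two s (sym (φ-⊕ -√5 -√5))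
    (¬Window! s) (¬Window! (u ⊗ s)) (window! (τ² ⊗ s))
    where
    s : ℤ[τ]
    s = -√5 ⊕ -√5

  L⊗≡2 : L⊗≡ 2
  L⊗≡2 = ⊗-digits , at-least-two s (sym (φ-⊗ -√5 -√5))
    (¬Window! s) (¬Window! (u ⊗ s)) (window! (τ² ⊗ s))
    where
    s : ℤ[τ]
    s = -√5 ⊗ -√5

theorem6p2 :
    ∀ {c ℓ₁ ℓ₂} (ℝ : Reals c ℓ₁ ℓ₂) → let open Reals ℝ in
    (√5 : Carrier) (0<√5 : 0# < √5) (√5²≈5 : √5 * √5 ≈ 5 · 1#) →
    let open RealProperties.GoldenRatio ℝ √5 0<√5 √5²≈5
        open MinusBeta ℝ τ 1<τ
    in (L⊕≡ 2) × (L⊗≡ 2)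
theorem6p2 ℝ √5 0<√5 √5²≈5 = L⊕≡2 , L⊗≡2
  where
  open RealProperties.GoldenRatio ℝ √5 0<√5 √5²≈5
  open GoldenIntegers ℝ τ 1<τ τ²≈1+τ
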